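{- For any positive integers $\alpha,m,n,r$, we have $$\sum_{k=0}^{n-1}[k(k+1)]^r\,[2k+1]\,q^{(n-1-k)(\alpha m+1)}\,w_k^{(\alpha)}(x;q)^m\equiv 0\pmod{[n]},$$ where the congruence is in the ring $\mathbb{Z}[q,q^{ -1}][x]$.
   Context: Here $q$ and $x$ are indeterminates. For an integer $N$, $[N]=\frac{1-q^N}{1-q}$ is the $q$-integer, an element of $\mathbb{Z}[q,q^{ -1}]$; in particular $[k(k+1)]$ is the $q$-integer of the number $k(k+1)$. For nonnegative integers $N$ and integers $k$, $\left[\begin{matrix} N \\ k \end{matrix}\right]=\frac{\prod_{1\le j\le k}[N-j+1]}{\prod_{1\le j\le k}[j]}$ is the $q$-binomial coefficient, equal to $1$ if $k=0$ and to $0$ if $k<0$ or $k>N$. For a nonnegative integer $k$ and a positive integer $\alpha$, $$w_k^{(\alpha)}(x;q)=\sum_{j=1}^{k}q^{\alpha\left(\binom{j+1}{2}-(k+1)(j-1)\right)}\left(\left[\begin{matrix} k-1 \\ j-1 \end{matrix}\right]\left[\begin{matrix} k+j \\ j \end{matrix}\right]-\left[\begin{matrix} k \\ j \end{matrix}\right]\left[\begin{matrix} k+j \\ j-1 \end{matrix}\right]\right)^{\alpha}x^{j-1}\in\mathbb{Z}[q,q^{ -1}][x],$$ with $w_0^{(\alpha)}(x;q)=0$ (empty sum). A congruence $A\equiv 0\pmod{P(q)}$ means that $P(q)$ divides $A$ in $\mathbb{Z}[q,q^{ -1}][x]$. -}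

module Defs where

open import Algebra.Bundles using (CommutativeRing; Semiring)
open import Algebra.Core using (Op₂)
open import Algebra.Structures using (IsCommutativeMonoid)
open import Data.Bool.Base using (if_then_else_)
open import Data.Empty using (⊥-elim)
open import Data.Fin.Base using (toℕ)
open import Data.Integer.Base as ℤ using (ℤ; +_; -[1+_]; ∣_∣)
import Data.Integer.Properties as ℤₚ
import Data.Integer.Tactic.RingSolver as ℤ-Solver
open import Data.List.Base using (List; []; _∷_; _++_; length; map)
open import Data.Nat.Base as ℕ using (ℕ; zero; suc; _∸_; z≤n; s≤s)
open import Data.Nat.Combinatorics using (_C_)
import Data.Nat.Properties as ℕₚ
open import Data.Product.Base using (_×_; _,_; proj₁; proj₂; ∃)
open import Data.Product using (∃!)
open import Level using (_⊔_)
open import Relation.Binary.Definitions using (DecidableEquality)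
open import Relation.Binary.PropositionalEquality as ≡ using (_≡_; _≢_)
open import Relation.Nullary using (does; yes; no)

-- The algebra R[E] of a commutative monoid E with decidable equality.  An
-- element is a list of terms r·e; exponents may be repeated and coefficients
-- may vanish, so equality is equality of all coefficients.

module MonoidAlgebra
  {c ℓ} (R : CommutativeRing c ℓ)
  {E : Set} {_∙_ : Op₂ E} {ε : E}
  (isCommutativeMonoid : IsCommutativeMonoid _≡_ _∙_ ε)
  (_≟_ : DecidableEquality E)
  where

  private
    module R = CommutativeRing R
    module E = IsCommutativeMonoid isCommutativeMonoid
    open import Algebra.Properties.Ring R.ring
      using (-‿distribˡ-*; -0#≈0#; -‿+-comm; x[y-z]≈xy-xz)
    open import Algebra.Properties.CommutativeSemigroup R.+-commutativeSemigroup
      using (interchange; x∙yz≈y∙xz)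
    open import Algebra.Properties.CommutativeSemigroup R.*-commutativeSemigroup
      using () renaming (x∙yz≈y∙xz to x*yz≈y*xz)
    open import Relation.Binary.Reasoning.Setoid R.setoid

  Element : Set c
  Element = List (R.Carrier × E)

  monomial : R.Carrier → E → Element
  monomial r e = (r , e) ∷ []

  coeff : Element → E → R.Carrier
  coeff []            d = R.0#
  coeff ((r , e) ∷ f) d = (if does (e ≟ d) then r else R.0#) R.+ coeff f d

  infix 4 _≈_
  record _≈_ (f g : Element) : Set ℓ where
    constructor coeffwise
    field coeff-≈ : ∀ d → coeff f d R.≈ coeff g d

  open _≈_ public

  infixl 7 _*_ _·_
  infixl 6 _+_
  infix  8 -_

  0# 1# : Element
  0# = []
  1# = monomial R.1# ε

  _+_ _*_ : Element → Element → Element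
  -_ : Element → Element
  _·_ : R.Carrier × E → Element → Element

  _+_ = _++_

  -_ = map (λ (r , e) → R.- r , e)

  (r , e) · g = map (λ (s , d) → r R.* s , e ∙ d) g

  []      * g = 0#
  (t ∷ f) * g = t · g + f * g

  -- Two elements are equal iff all linear functionals agree on them; the ring
  -- laws are checked in this form.

  linear : (E → R.Carrier) → Element → R.Carrier
  linear φ []            = R.0#
  linear φ ((r , e) ∷ f) = r R.* φ e R.+ linear φ f

  private
    δ : E → E → R.Carrier
    δ d e = if does (e ≟ d) then R.1# else R.0#

    coeff-linear : ∀ f d → coeff f d R.≈ linear (δ d) f
    coeff-linear []            d = R.refl
    coeff-linear ((r , e) ∷ f) d with e ≟ d
    ... | yes _ = R.+-cong (R.sym (R.*-identityʳ r)) (coeff-linear f d)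
    ... | no  _ = R.+-cong (R.sym (R.zeroʳ r)) (coeff-linear f d)

    remove : E → Element → Element
    remove d []            = []
    remove d ((r , e) ∷ f) with e ≟ d
    ... | yes _ = remove d f
    ... | no  _ = (r , e) ∷ remove d f

    length-remove : ∀ d f → length (remove d f) ℕ.≤ length f
    length-remove d []            = z≤n
    length-remove d ((r , e) ∷ f) with e ≟ d
    ... | yes _ = ℕₚ.m≤n⇒m≤1+n (length-remove d f)
    ... | no  _ = s≤s (length-remove d f)

    linear-remove : ∀ φ d f →
      linear φ f R.≈ coeff f d R.* φ d R.+ linear φ (remove d f)
    linear-remove φ d [] = R.sym (R.trans (R.+-identityʳ _) (R.zeroˡ _))
    linear-remove φ d ((r , e) ∷ f) with e ≟ d
    ... | yes ≡.refl = begin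
      r R.* φ e R.+ linear φ f
        ≈⟨ R.+-congˡ (linear-remove φ e f) ⟩
      r R.* φ e R.+ (coeff f e R.* φ e R.+ linear φ (remove e f))
        ≈⟨ R.+-assoc _ _ _ ⟨
      r R.* φ e R.+ coeff f e R.* φ e R.+ linear φ (remove e f)
        ≈⟨ R.+-congʳ (R.distribʳ _ _ _) ⟨
      (r R.+ coeff f e) R.* φ e R.+ linear φ (remove e f) ∎
    ... | no _ = begin
      r R.* φ e R.+ linear φ f
        ≈⟨ R.+-congˡ (linear-remove φ d f) ⟩
      r R.* φ e R.+ (coeff f d R.* φ d R.+ linear φ (remove d f))
        ≈⟨ x∙yz≈y∙xz _ _ _ ⟩
      coeff f d R.* φ d R.+ (r R.* φ e R.+ linear φ (remove d f))
        ≈⟨ R.+-congʳ (R.*-congʳ (R.+-identityˡ _)) ⟨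
      (R.0# R.+ coeff f d) R.* φ d R.+ (r R.* φ e R.+ linear φ (remove d f)) ∎

    coeff-remove-≡ : ∀ d f → coeff (remove d f) d R.≈ R.0#
    coeff-remove-≡ d []            = R.refl
    coeff-remove-≡ d ((r , e) ∷ f) with e ≟ d in eq
    ... | yes _ = coeff-remove-≡ d f
    ... | no  _ rewrite eq = R.trans (R.+-identityˡ _) (coeff-remove-≡ d f)

    coeff-remove-≢ : ∀ d f x → d ≢ x → coeff (remove d f) x R.≈ coeff f x
    coeff-remove-≢ d []            x d≢x = R.refl
    coeff-remove-≢ d ((r , e) ∷ f) x d≢x with e ≟ d
    ... | no _ = R.+-congˡ (coeff-remove-≢ d f x d≢x)
    ... | yes ≡.refl with e ≟ x
    ...   | yes e≡x = ⊥-elim (d≢x e≡x)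
    ...   | no  _   = R.trans (coeff-remove-≢ e f x d≢x) (R.sym (R.+-identityˡ _))

    linear-zero : ∀ n φ f → length f ℕ.≤ n →
                  (∀ d → coeff f d R.≈ R.0#) → linear φ f R.≈ R.0#
    linear-zero n       φ []                 _         f≈0 = R.refl
    linear-zero (suc n) φ f′@((r , e) ∷ f) (s≤s f≤n) f≈0 = begin
      linear φ f′
        ≈⟨ linear-remove φ e f′ ⟩
      coeff f′ e R.* φ e R.+ linear φ (remove e f′)
        ≈⟨ R.+-cong (R.trans (R.*-congʳ (f≈0 e)) (R.zeroˡ _))
                    (linear-zero n φ (remove e f′) shorter vanishes) ⟩
      R.0# R.+ R.0#
        ≈⟨ R.+-identityˡ _ ⟩
      R.0# ∎
      where
      shorter : length (remove e f′) ℕ.≤ n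
      shorter with e ≟ e
      ... | yes _   = ℕₚ.≤-trans (length-remove e f) f≤n
      ... | no  e≢e = ⊥-elim (e≢e ≡.refl)
      vanishes : ∀ d → coeff (remove e f′) d R.≈ R.0#
      vanishes d with e ≟ d
      ... | yes ≡.refl = coeff-remove-≡ e f′
      ... | no  e≢d    = R.trans (coeff-remove-≢ e f′ d e≢d) (f≈0 d)

  linear-+ : ∀ φ f g → linear φ (f + g) R.≈ linear φ f R.+ linear φ g
  linear-+ φ []            g = R.sym (R.+-identityˡ _)
  linear-+ φ ((r , e) ∷ f) g =
    R.trans (R.+-congˡ (linear-+ φ f g)) (R.sym (R.+-assoc _ _ _))

  linear-neg : ∀ φ f → linear φ (- f) R.≈ R.- linear φ f
  linear-neg φ []            = R.sym -0#≈0#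
  linear-neg φ ((r , e) ∷ f) =
    R.trans (R.+-cong (R.sym (-‿distribˡ-* r (φ e))) (linear-neg φ f))
            (-‿+-comm _ _)

  linear-cong : ∀ φ {f g} → f ≈ g → linear φ f R.≈ linear φ g
  linear-cong φ {f} {g} f≈g = begin
    linear φ f
      ≈⟨ R.+-identityʳ _ ⟨
    linear φ f R.+ R.0#
      ≈⟨ R.+-congˡ (R.-‿inverseˡ _) ⟨
    linear φ f R.+ (R.- linear φ g R.+ linear φ g)
      ≈⟨ R.+-assoc _ _ _ ⟨
    linear φ f R.+ R.- linear φ g R.+ linear φ g
      ≈⟨ R.+-congʳ (difference φ) ⟨
    linear φ (f + - g) R.+ linear φ g
      ≈⟨ R.+-congʳ (linear-zero _ φ (f + - g) ℕₚ.≤-refl λ d →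
           R.trans (coeff-linear (f + - g) d)
          (R.trans (difference (δ d))
          (R.trans (R.+-cong (R.sym (coeff-linear f d))
                             (R.-‿cong (R.sym (coeff-linear g d))))
          (R.trans (R.+-congʳ (coeff-≈ f≈g d)) (R.-‿inverseʳ _))))) ⟩
    R.0# R.+ linear φ g
      ≈⟨ R.+-identityˡ _ ⟩
    linear φ g ∎
    where
    difference : ∀ ψ → linear ψ (f + - g) R.≈ linear ψ f R.- linear ψ g
    difference ψ = R.trans (linear-+ ψ f (- g)) (R.+-congˡ (linear-neg ψ g))

  linear-ext : ∀ f g → (∀ φ → linear φ f R.≈ linear φ g) → f ≈ g
  linear-ext f g f≈g = coeffwise λ d →
    R.trans (coeff-linear f d) (R.trans (f≈g (δ d)) (R.sym (coeff-linear g d)))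

  linear-congˡ : ∀ {φ ψ} f → (∀ e → φ e R.≈ ψ e) → linear φ f R.≈ linear ψ f
  linear-congˡ []            φ≈ψ = R.refl
  linear-congˡ ((r , e) ∷ f) φ≈ψ =
    R.+-cong (R.*-congˡ (φ≈ψ e)) (linear-congˡ f φ≈ψ)

  private
    linear-0 : ∀ f → linear (λ _ → R.0#) f R.≈ R.0#
    linear-0 []            = R.refl
    linear-0 ((r , e) ∷ f) =
      R.trans (R.+-cong (R.zeroʳ r) (linear-0 f)) (R.+-identityˡ _)

    linear-distrib : ∀ φ ψ f →
      linear (λ e → φ e R.+ ψ e) f R.≈ linear φ f R.+ linear ψ f
    linear-distrib φ ψ []            = R.sym (R.+-identityˡ _)
    linear-distrib φ ψ ((r , e) ∷ f) =
      R.trans (R.+-cong (R.distribˡ _ _ _) (linear-distrib φ ψ f))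
              (interchange _ _ _ _)

    linear-scale : ∀ s φ f → linear (λ e → s R.* φ e) f R.≈ s R.* linear φ f
    linear-scale s φ []            = R.sym (R.zeroʳ s)
    linear-scale s φ ((r , e) ∷ f) =
      R.trans (R.+-cong (x*yz≈y*xz r s _) (linear-scale s φ f))
              (R.sym (R.distribˡ _ _ _))

    linear-swap : ∀ (φ : E → E → R.Carrier) f g →
      linear (λ e → linear (φ e) g) f R.≈ linear (λ d → linear (λ e → φ e d) f) g
    linear-swap φ []            g = R.sym (linear-0 g)
    linear-swap φ ((r , e) ∷ f) g =
      R.trans (R.+-cong (R.sym (linear-scale r (φ e) g)) (linear-swap φ f g))
              (R.sym (linear-distrib _ _ g))

    linear-· : ∀ φ r e g →
      linear φ ((r , e) · g) R.≈ r R.* linear (λ d → φ (e ∙ d)) g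
    linear-· φ r e []            = R.sym (R.zeroʳ r)
    linear-· φ r e ((s , d) ∷ g) =
      R.trans (R.+-cong (R.*-assoc _ _ _) (linear-· φ r e g))
              (R.sym (R.distribˡ _ _ _))

  linear-* : ∀ φ f g →
    linear φ (f * g) R.≈ linear (λ e → linear (λ d → φ (e ∙ d)) g) f
  linear-* φ []            g = R.refl
  linear-* φ ((r , e) ∷ f) g =
    R.trans (linear-+ φ ((r , e) · g) (f * g))
            (R.+-cong (linear-· φ r e g) (linear-* φ f g))

  private
    ≈-refl : ∀ {f} → f ≈ f
    ≈-refl = coeffwise λ d → R.refl

    ≈-sym : ∀ {f g} → f ≈ g → g ≈ f
    ≈-sym p = coeffwise λ d → R.sym (coeff-≈ p d)

    ≈-trans : ∀ {f g h} → f ≈ g → g ≈ h → f ≈ h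
    ≈-trans p q = coeffwise λ d → R.trans (coeff-≈ p d) (coeff-≈ q d)

    +-cong′ : ∀ {f f′ g g′} → f ≈ f′ → g ≈ g′ → f + g ≈ f′ + g′
    +-cong′ {f} {f′} {g} {g′} p q = linear-ext (f + g) (f′ + g′) λ φ →
      R.trans (linear-+ φ f g)
     (R.trans (R.+-cong (linear-cong φ p) (linear-cong φ q))
              (R.sym (linear-+ φ f′ g′)))

    -‿cong′ : ∀ {f g} → f ≈ g → - f ≈ - g
    -‿cong′ {f} {g} p = linear-ext (- f) (- g) λ φ →
      R.trans (linear-neg φ f)
     (R.trans (R.-‿cong (linear-cong φ p)) (R.sym (linear-neg φ g)))

    +-assoc′ : ∀ f g h → (f + g) + h ≈ f + (g + h)
    +-assoc′ []      g h = ≈-refl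
    +-assoc′ (t ∷ f) g h = coeffwise λ d → R.+-congˡ (coeff-≈ (+-assoc′ f g h) d)

    +-comm′ : ∀ f g → f + g ≈ g + f
    +-comm′ f g = linear-ext (f + g) (g + f) λ φ →
      R.trans (linear-+ φ f g)
     (R.trans (R.+-comm _ _) (R.sym (linear-+ φ g f)))

    +-identityʳ′ : ∀ f → f + 0# ≈ f
    +-identityʳ′ []      = ≈-refl
    +-identityʳ′ (t ∷ f) = coeffwise λ d → R.+-congˡ (coeff-≈ (+-identityʳ′ f) d)

    inverseˡ : ∀ f → - f + f ≈ 0#
    inverseˡ f = linear-ext (- f + f) 0# λ φ →
      R.trans (linear-+ φ (- f) f)
     (R.trans (R.+-congʳ (linear-neg φ f)) (R.-‿inverseˡ _))

    *-comm′ : ∀ f g → f * g ≈ g * f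
    *-comm′ f g = linear-ext (f * g) (g * f) λ φ →
      R.trans (linear-* φ f g)
     (R.trans (linear-swap (λ e d → φ (e ∙ d)) f g)
     (R.trans (linear-congˡ g λ d → linear-congˡ f λ e →
                 R.reflexive (≡.cong φ (E.comm e d)))
              (R.sym (linear-* φ g f))))

    *-cong′ : ∀ {f f′ g g′} → f ≈ f′ → g ≈ g′ → f * g ≈ f′ * g′
    *-cong′ {f} {f′} {g} {g′} p q = linear-ext (f * g) (f′ * g′) λ φ →
      R.trans (linear-* φ f g)
     (R.trans (linear-cong _ p)
     (R.trans (linear-congˡ f′ λ e → linear-cong (λ d → φ (e ∙ d)) q)
              (R.sym (linear-* φ f′ g′))))

    *-assoc′ : ∀ f g h → (f * g) * h ≈ f * (g * h)
    *-assoc′ f g h = linear-ext ((f * g) * h) (f * (g * h)) λ φ → begin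
      linear φ ((f * g) * h)
        ≈⟨ linear-* φ (f * g) h ⟩
      linear (λ a → linear (λ b → φ (a ∙ b)) h) (f * g)
        ≈⟨ linear-* _ f g ⟩
      linear (λ a → linear (λ b → linear (λ c → φ ((a ∙ b) ∙ c)) h) g) f
        ≈⟨ linear-congˡ f (λ a → linear-congˡ g λ b → linear-congˡ h λ c →
             R.reflexive (≡.cong φ (E.assoc a b c))) ⟩
      linear (λ a → linear (λ b → linear (λ c → φ (a ∙ (b ∙ c))) h) g) f
        ≈⟨ linear-congˡ f (λ a → linear-* (λ x → φ (a ∙ x)) g h) ⟨
      linear (λ a → linear (λ x → φ (a ∙ x)) (g * h)) f
        ≈⟨ linear-* φ f (g * h) ⟨
      linear φ (f * (g * h)) ∎

    *-identityˡ′ : ∀ f → 1# * f ≈ f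
    *-identityˡ′ f = linear-ext (1# * f) f λ φ →
      R.trans (linear-* φ 1# f)
     (R.trans (R.+-identityʳ _)
     (R.trans (R.*-identityˡ _)
              (linear-congˡ f λ e → R.reflexive (≡.cong φ (E.identityˡ e)))))

    distribʳ′ : ∀ h f g → (f + g) * h ≈ f * h + g * h
    distribʳ′ h f g = linear-ext ((f + g) * h) (f * h + g * h) λ φ →
      R.trans (linear-* φ (f + g) h)
     (R.trans (linear-+ _ f g)
     (R.trans (R.+-cong (R.sym (linear-* φ f h)) (R.sym (linear-* φ g h)))
              (R.sym (linear-+ φ (f * h) (g * h)))))

  commutativeRing : CommutativeRing c ℓ
  commutativeRing = record
    { Carrier = Element ; _≈_ = _≈_ ; _+_ = _+_ ; _*_ = _*_ ; -_ = -_
    ; 0# = 0# ; 1# = 1#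
    ; isCommutativeRing = record
      { isRing = record
        { +-isAbelianGroup = record
          { isGroup = record
            { isMonoid = record
              { isSemigroup = record
                { isMagma = record
                  { isEquivalence = record
                    { refl = ≈-refl ; sym = ≈-sym ; trans = ≈-trans }
                  ; ∙-cong = +-cong′
                  }
                ; assoc = +-assoc′
                }
              ; identity = (λ f → ≈-refl) , +-identityʳ′
              }
            ; inverse =
                inverseˡ , λ f → ≈-trans (+-comm′ f (- f)) (inverseˡ f)
            ; ⁻¹-cong = -‿cong′
            }
          ; comm = +-comm′
          }
        ; *-cong = *-cong′
        ; *-assoc = *-assoc′
        ; *-identity =
            *-identityˡ′ , λ f → ≈-trans (*-comm′ f 1#) (*-identityˡ′ f)
        ; distrib =
            (λ h f g → ≈-trans (*-comm′ h (f + g))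
                      (≈-trans (distribʳ′ h f g)
                               (+-cong′ (*-comm′ f h) (*-comm′ g h))))
          , distribʳ′
        }
      ; *-comm = *-comm′
      }
    }

module RingNotation {c ℓ} (R : CommutativeRing c ℓ) where
  open CommutativeRing R public hiding (zero)
  open import Algebra.Definitions.RawSemiring (Semiring.rawSemiring semiring)
    public using (_^_; _∣_; sum; product)

  sum<-syntax sum≤-syntax product≤-syntax : ℕ → (ℕ → Carrier) → Carrier
  sum<-syntax     n f = sum     {n} λ i → f (toℕ i)
  sum≤-syntax     n f = sum     {n} λ i → f (suc (toℕ i))
  product≤-syntax n f = product {n} λ i → f (suc (toℕ i))

  infix 10 sum<-syntax sum≤-syntax product≤-syntax
  syntax sum<-syntax     n (λ i → a) = ∑[0≤ i < n ] a
  syntax sum≤-syntax     n (λ i → a) = ∑[1≤ i ≤ n ] a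
  syntax product≤-syntax n (λ i → a) = ∏[1≤ i ≤ n ] a

  Quotient : Carrier → Carrier → Set (c ⊔ ℓ)
  Quotient a b = ∃! _≈_ λ d → d * b ≈ a

  Regular : Carrier → Set (c ⊔ ℓ)
  Regular b = ∀ {d} → d * b ≈ 0# → d ≈ 0#

module RingLemmas {c ℓ} (R : CommutativeRing c ℓ) where
  open RingNotation R
  open import Algebra.Properties.Ring ring
  open import Relation.Binary.Reasoning.Setoid setoid

  x-y≈0⇒x≈y : ∀ a b → a - b ≈ 0# → a ≈ b
  x-y≈0⇒x≈y a b eq = trans (+-inverseˡ-unique a (- b) eq) (-‿involutive b)

  regular-cancel : ∀ {b} → Regular b → ∀ {d e} → d * b ≈ e * b → d ≈ e
  regular-cancel {b} reg {d} {e} eq = x-y≈0⇒x≈y _ _ (reg (begin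
    (d - e) * b    ≈⟨ [y-z]x≈yx-zx b d e ⟩
    d * b - e * b  ≈⟨ +-congʳ eq ⟩
    e * b - e * b  ≈⟨ -‿inverseʳ _ ⟩
    0#             ∎))

  regular-1 : Regular 1#
  regular-1 eq = trans (sym (*-identityʳ _)) eq

  regular-* : ∀ {a b} → Regular a → Regular b → Regular (a * b)
  regular-* ra rb eq = ra (rb (trans (*-assoc _ _ _) eq))

  regular-factor : ∀ {a b} → Regular (a * b) → Regular a
  regular-factor {a} {b} r {d} eq =
    r (trans (sym (*-assoc d a b)) (trans (*-congʳ eq) (zeroˡ b)))

  regular-resp : ∀ {a b} → a ≈ b → Regular a → Regular b
  regular-resp eq r da≈0 = r (trans (*-congˡ eq) da≈0)

  regular-product : ∀ n f → (∀ i → Regular (f (suc i))) →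
                    Regular (∏[1≤ i ≤ n ] f i)
  regular-product zero    f r = regular-1
  regular-product (suc n) f r =
    regular-* (r 0) (regular-product n (λ i → f (suc i)) λ i → r (suc i))

  quotient : ∀ {a b} → Regular b → ∀ d → d * b ≈ a → Quotient a b
  quotient reg d eq = d , eq , λ eq′ → regular-cancel reg (trans eq (sym eq′))

  product-cong : ∀ n {f g : ℕ → Carrier} → (∀ i → f i ≈ g i) →
                 ∏[1≤ i ≤ n ] f i ≈ ∏[1≤ i ≤ n ] g i
  product-cong zero    eq = refl
  product-cong (suc n) eq = *-cong (eq 1) (product-cong n λ i → eq (suc i))

  product-last : ∀ n f → ∏[1≤ i ≤ suc n ] f i ≈ ∏[1≤ i ≤ n ] f i * f (suc n)
  product-last zero    f = trans (*-identityʳ _) (sym (*-identityˡ _))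
  product-last (suc n) f =
    trans (*-congˡ (product-last n λ i → f (suc i))) (sym (*-assoc _ _ _))

record RegularPowers {c ℓ} (R : CommutativeRing c ℓ)
                     (q^_ : ℤ → CommutativeRing.Carrier R) : Set (c ⊔ ℓ) where
  open RingNotation R
  field
    q^-0         : q^ ℤ.0ℤ ≈ 1#
    q^-+         : ∀ a b → q^ a * q^ b ≈ q^ (a ℤ.+ b)
    regular-1-q^ : ∀ j → Regular (1# - q^ (+ suc j))

module QAnalogues {c ℓ} (R : CommutativeRing c ℓ)
                  (q^_ : ℤ → CommutativeRing.Carrier R)
                  (regularPowers : RegularPowers R q^_) where
  open RingNotation R
  open RegularPowers regularPowers

  infix 9 1-q^_
  1-q^_ : ℤ → Carrier
  1-q^ z = 1# - q^ z

  open RingLemmas R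
  open import Algebra.Properties.Ring ring
    using (x[y-z]≈xy-xz; +-inverseˡ-unique; -‿distribˡ-*)
  open import Algebra.Properties.CommutativeSemigroup *-commutativeSemigroup
    using (x∙yz≈y∙xz)
  open import Relation.Binary.Reasoning.Setoid setoid

  telescope : ∀ a b → 1-q^ a + q^ a * 1-q^ b ≈ 1-q^ (a ℤ.+ b)
  telescope a b = begin
    1# - q^ a + q^ a * (1# - q^ b)
      ≈⟨ +-congˡ (x[y-z]≈xy-xz (q^ a) 1# (q^ b)) ⟩
    1# - q^ a + (q^ a * 1# - q^ a * q^ b)
      ≈⟨ +-congˡ (+-cong (*-identityʳ (q^ a)) (-‿cong (q^-+ a b))) ⟩
    1# - q^ a + (q^ a - q^ (a ℤ.+ b))
      ≈⟨ +-assoc 1# (- q^ a) _ ⟩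
    1# + (- q^ a + (q^ a - q^ (a ℤ.+ b)))
      ≈⟨ +-congˡ (+-assoc (- q^ a) (q^ a) _) ⟨
    1# + (- q^ a + q^ a - q^ (a ℤ.+ b))
      ≈⟨ +-congˡ (+-congʳ (-‿inverseˡ (q^ a))) ⟩
    1# + (0# - q^ (a ℤ.+ b))
      ≈⟨ +-congˡ (+-identityˡ _) ⟩
    1-q^ (a ℤ.+ b) ∎

  telescope-* : ∀ a b d e y → d * y ≈ 1-q^ a → e * y ≈ 1-q^ b →
                (d + q^ a * e) * y ≈ 1-q^ (a ℤ.+ b)
  telescope-* a b d e y eq₁ eq₂ = begin
    (d + q^ a * e) * y       ≈⟨ distribʳ y d _ ⟩
    d * y + q^ a * e * y     ≈⟨ +-congˡ (*-assoc (q^ a) e y) ⟩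
    d * y + q^ a * (e * y)   ≈⟨ +-cong eq₁ (*-congˡ eq₂) ⟩
    1-q^ a + q^ a * 1-q^ b   ≈⟨ telescope a b ⟩
    1-q^ (a ℤ.+ b)           ∎

  geometric : ℕ → Carrier
  geometric zero    = 0#
  geometric (suc n) = 1# + q^ (+ 1) * geometric n

  geometric-spec : ∀ n → geometric n * 1-q^ (+ 1) ≈ 1-q^ (+ n)
  geometric-spec zero    = begin
    0# * 1-q^ (+ 1)  ≈⟨ zeroˡ _ ⟩
    0#               ≈⟨ -‿inverseʳ 1# ⟨
    1# - 1#          ≈⟨ +-congˡ (-‿cong q^-0) ⟨
    1-q^ ℤ.0ℤ        ∎
  geometric-spec (suc n) =
    telescope-* (+ 1) (+ n) 1# (geometric n) _ (*-identityˡ _)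
      (geometric-spec n)

  negative-spec : ∀ n →
    - (q^ -[1+ n ] * geometric (suc n)) * 1-q^ (+ 1) ≈ 1-q^ -[1+ n ]
  negative-spec n = begin
    - (q^ -[1+ n ] * geometric (suc n)) * 1-q^ (+ 1)
      ≈⟨ -‿distribˡ-* _ _ ⟨
    - (q^ -[1+ n ] * geometric (suc n) * 1-q^ (+ 1))
      ≈⟨ -‿cong (trans (*-assoc (q^ -[1+ n ]) _ _)
                       (*-congˡ (geometric-spec (suc n)))) ⟩
    - (q^ -[1+ n ] * 1-q^ (+ suc n))
      ≈⟨ +-inverseˡ-unique _ _ (trans (telescope -[1+ n ] (+ suc n)) 1-q⁰≈0) ⟨
    1-q^ -[1+ n ] ∎
    where
    1-q⁰≈0 : 1-q^ (-[1+ n ] ℤ.+ + suc n) ≈ 0#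
    1-q⁰≈0 = begin
      1-q^ (-[1+ n ] ℤ.+ + suc n)
        ≡⟨ ≡.cong 1-q^_ (ℤₚ.+-inverseˡ (+ suc n)) ⟩
      1-q^ ℤ.0ℤ  ≈⟨ +-congˡ (-‿cong q^-0) ⟩
      1# - 1#    ≈⟨ -‿inverseʳ 1# ⟩
      0#         ∎

  q-integer : ∀ N → Quotient (1# - q^ N) (1# - q^ (+ 1))
  q-integer (+ n)    =
    quotient (regular-1-q^ 0) (geometric n) (geometric-spec n)
  q-integer -[1+ n ] =
    quotient (regular-1-q^ 0) (- (q^ -[1+ n ] * geometric (suc n)))
             (negative-spec n)

  [_] : ℤ → Carrier
  [ N ] = proj₁ (q-integer N)

  []-spec : ∀ N → [ N ] * 1-q^ (+ 1) ≈ 1-q^ N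
  []-spec N = proj₁ (proj₂ (q-integer N))

  []-+ : ∀ a b → [ a ] + q^ a * [ b ] ≈ [ a ℤ.+ b ]
  []-+ a b = regular-cancel (regular-1-q^ 0)
    (trans (telescope-* a b [ a ] [ b ] _ ([]-spec a) ([]-spec b))
           (sym ([]-spec (a ℤ.+ b))))

  regular-[] : ∀ j → Regular [ + suc j ]
  regular-[] j =
    regular-factor (regular-resp (sym ([]-spec (+ suc j))) (regular-1-q^ j))

  numerator : ℕ → ℕ → Carrier
  numerator N k = ∏[1≤ j ≤ k ] [ + N ℤ.- + j ℤ.+ + 1 ]

  denominator : ℕ → Carrier
  denominator k = ∏[1≤ j ≤ k ] [ + j ]

  pascal : ℕ → ℕ → Carrier
  pascal n       zero    = 1#
  pascal zero    (suc k) = 0#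
  pascal (suc n) (suc k) = pascal n k + q^ (+ suc k) * pascal n (suc k)

  pascal-spec : ∀ n k → pascal n k * denominator k ≈ numerator n k
  pascal-spec n       zero    = *-identityˡ 1#
  pascal-spec zero    (suc k) =
    trans (zeroˡ _) (sym (zeroˡ _))
  pascal-spec (suc n) (suc k) = begin
    (pascal n k + Q * pascal n (suc k)) * D′
      ≈⟨ distribʳ D′ _ _ ⟩
    pascal n k * D′ + Q * pascal n (suc k) * D′
      ≈⟨ +-cong (*-congˡ (product-last k (λ j → [ + j ])))
                (*-assoc Q _ D′) ⟩
    pascal n k * (D * [ + suc k ]) + Q * (pascal n (suc k) * D′)
      ≈⟨ +-cong (sym (*-assoc _ D _)) (*-congˡ (pascal-spec n (suc k))) ⟩
    pascal n k * D * [ + suc k ] + Q * numerator n (suc k)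
      ≈⟨ +-cong (*-congʳ (pascal-spec n k))
                (*-congˡ (product-last k (λ j → [ + n ℤ.- + j ℤ.+ + 1 ]))) ⟩
    F * [ + suc k ] + Q * (F * [ + n ℤ.- + suc k ℤ.+ + 1 ])
      ≈⟨ +-congˡ (x∙yz≈y∙xz Q F _) ⟩
    F * [ + suc k ] + F * (Q * [ + n ℤ.- + suc k ℤ.+ + 1 ])
      ≈⟨ distribˡ F _ _ ⟨
    F * ([ + suc k ] + Q * [ + n ℤ.- + suc k ℤ.+ + 1 ])
      ≈⟨ *-congˡ ([]-+ (+ suc k) (+ n ℤ.- + suc k ℤ.+ + 1)) ⟩
    F * [ + suc k ℤ.+ (+ n ℤ.- + suc k ℤ.+ + 1) ]
      ≈⟨ *-comm F _ ⟩
    [ + suc k ℤ.+ (+ n ℤ.- + suc k ℤ.+ + 1) ] * F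
      ≈⟨ *-cong (reflexive (≡.cong [_] (top (+ suc k) (+ n))))
                (product-cong k λ j →
                   reflexive (≡.cong [_] (shift (+ n) (+ j)))) ⟩
    numerator (suc n) (suc k) ∎
    where
    Q = q^ (+ suc k)
    D = denominator k
    D′ = denominator (suc k)
    F = numerator n k
    top : ∀ a b → a ℤ.+ (b ℤ.- a ℤ.+ + 1) ≡ + 1 ℤ.+ b ℤ.- + 1 ℤ.+ + 1
    top = ℤ-Solver.solve-∀
    shift : ∀ a b → a ℤ.- b ℤ.+ + 1 ≡ + 1 ℤ.+ a ℤ.- (+ 1 ℤ.+ b) ℤ.+ + 1
    shift = ℤ-Solver.solve-∀

  -- For k > N the numerator contains the factor [ + 0 ], so the value is 0.

  q-binomial : ∀ N k → Quotient (∏[1≤ j ≤ k ] [ + N ℤ.- + j ℤ.+ + 1 ])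
                                (∏[1≤ j ≤ k ] [ + j ])
  q-binomial N k =
    quotient (regular-product k (λ j → [ + j ]) regular-[])
             (pascal N k) (pascal-spec N k)

  [_choose_] : ℕ → ℕ → Carrier
  [ N choose k ] = proj₁ (q-binomial N k)

-- ℤ[q,q⁻¹] is the group algebra of (ℤ, +): the term (r , z) is r q^z.

module ℤ[ℤ] = MonoidAlgebra
  ℤₚ.+-*-commutativeRing ℤₚ.+-0-isCommutativeMonoid ℤₚ._≟_

module L = RingNotation ℤ[ℤ].commutativeRing

Laurent : Set
Laurent = L.Carrier

infix 9 q^_
q^_ : ℤ → Laurent
q^ z = ℤ[ℤ].monomial ℤ.1ℤ z

-- ℤ[q,q⁻¹][x] is the algebra of (ℕ, +) over ℤ[q,q⁻¹]: the term (a , i) is a xⁱ.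

module L[ℕ] = MonoidAlgebra
  ℤ[ℤ].commutativeRing ℕₚ.+-0-isCommutativeMonoid ℕₚ._≟_

module P = RingNotation L[ℕ].commutativeRing

Poly : Set
Poly = P.Carrier

const : Laurent → Poly
const a = L[ℕ].monomial a 0

x : Poly
x = L[ℕ].monomial L.1# 1

module LaurentProperties where
  open ℤ[ℤ] using (coeff; coeff-≈; coeffwise)
  open L
  open RingLemmas ℤ[ℤ].commutativeRing
  open import Algebra.Properties.Ring ring using (x[y-z]≈xy-xz)
  open import Algebra.Properties.AbelianGroup ℤₚ.+-0-abelianGroup
    using (xyx⁻¹≈y) renaming (∙-cancelʳ to ℤ-cancelʳ)
  open import Relation.Binary.Reasoning.Setoid setoid

  coeff-shift : ∀ f z d → coeff (f * q^ z) (d ℤ.+ z) ≡ coeff f d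
  coeff-shift []            z d = ≡.refl
  coeff-shift ((r , e) ∷ f) z d with e ℤ.+ z ℤₚ.≟ d ℤ.+ z | e ℤₚ.≟ d
  ... | yes _  | yes _   = ≡.cong₂ ℤ._+_ (ℤₚ.*-identityʳ r) (coeff-shift f z d)
  ... | no  _  | no  _   = ≡.cong (ℤ._+_ ℤ.0ℤ) (coeff-shift f z d)
  ... | yes eq | no  e≢d = ⊥-elim (e≢d (ℤ-cancelʳ z e d eq))
  ... | no neq | yes e≡d = ⊥-elim (neq (≡.cong (λ a → a ℤ.+ z) e≡d))

  coeff-vanishes : ∀ f d j → ∃ λ T → ∀ t → T ℕ.≤ t →
                   coeff f (d ℤ.+ + (t ℕ.* suc j)) ≡ ℤ.0ℤ
  coeff-vanishes []            d j = 0 , λ _ _ → ≡.refl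
  coeff-vanishes ((r , e) ∷ f) d j with coeff-vanishes f d j
  ... | T , vanishes = suc ∣ e ℤ.- d ∣ ℕ.⊔ T , vanishes′
    where
    vanishes′ : ∀ t → suc ∣ e ℤ.- d ∣ ℕ.⊔ T ℕ.≤ t →
                coeff ((r , e) ∷ f) (d ℤ.+ + (t ℕ.* suc j)) ≡ ℤ.0ℤ
    vanishes′ t T′≤t with e ℤₚ.≟ d ℤ.+ + (t ℕ.* suc j)
    ... | no  _      = ≡.trans (ℤₚ.+-identityˡ _)
                         (vanishes t (ℕₚ.≤-trans (ℕₚ.m≤n⊔m _ T) T′≤t))
    ... | yes ≡.refl = ⊥-elim (ℕₚ.<-irrefl ≡.refl (ℕₚ.<-≤-trans
                         (ℕₚ.≤-trans (ℕₚ.m≤m⊔n _ T) T′≤t)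
                         (≡.subst (t ℕ.≤_) (≡.sym (≡.cong ∣_∣ cancel))
                           (ℕₚ.m≤m*n t (suc j)))))
      where
      cancel : d ℤ.+ + (t ℕ.* suc j) ℤ.- d ≡ + (t ℕ.* suc j)
      cancel = xyx⁻¹≈y d (+ (t ℕ.* suc j))

  regular-1-q^ : ∀ j → Regular (1# - q^ (+ suc j))
  regular-1-q^ j {f} f[1-qᴺ]≈0 = coeffwise λ d →
    let T , vanishes = coeff-vanishes f d j
    in ≡.trans (≡.sym (periodic T d)) (vanishes T ℕₚ.≤-refl)
    where
    N = + suc j
    f≈fqᴺ : f ≈ f * q^ N
    f≈fqᴺ = x-y≈0⇒x≈y _ _ (begin
      f - f * q^ N       ≈⟨ +-congʳ (*-identityʳ f) ⟨
      f * 1# - f * q^ N  ≈⟨ x[y-z]≈xy-xz f _ _ ⟨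
      f * (1# - q^ N)    ≈⟨ f[1-qᴺ]≈0 ⟩
      0#                 ∎)
    step : ∀ d → coeff f (d ℤ.+ N) ≡ coeff f d
    step d = ≡.trans (coeff-≈ f≈fqᴺ (d ℤ.+ N)) (coeff-shift f N d)
    periodic : ∀ t d → coeff f (d ℤ.+ + (t ℕ.* suc j)) ≡ coeff f d
    periodic zero    d = ≡.cong (coeff f) (ℤₚ.+-identityʳ d)
    periodic (suc t) d = ≡.trans
      (≡.cong (coeff f) (≡.sym (ℤₚ.+-assoc d N (+ (t ℕ.* suc j)))))
      (≡.trans (periodic t (d ℤ.+ N)) (step d))

  regularPowers : RegularPowers ℤ[ℤ].commutativeRing q^_
  regularPowers = record
    { q^-0         = refl
    ; q^-+         = λ a b → refl
    ; regular-1-q^ = regular-1-q^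
    }

open QAnalogues ℤ[ℤ].commutativeRing q^_ LaurentProperties.regularPowers public
  using (q-integer; [_]; q-binomial; [_choose_])

open P public using (sum<-syntax; sum≤-syntax)

-- In each summand 1 ≤ j ≤ k, so the natural-number subtractions are exact.

w : ℕ → ℕ → Poly
w α k = ∑[1≤ j ≤ k ]
  (const (q^ (+ α ℤ.* (+ (suc j C 2) ℤ.- (+ k ℤ.+ + 1) ℤ.* (+ j ℤ.- + 1)))
          L.* ([ k ∸ 1 choose j ∸ 1 ] L.* [ k ℕ.+ j choose j ]
               L.- [ k choose j ] L.* [ k ℕ.+ j choose j ∸ 1 ]) L.^ α)
   P.* x P.^ (j ∸ 1))

{-# OPTIONS --safe #-}

-- Let d ∣ n with d > 1, let q be a primitive d-th root of unity, and split
-- 0 ≤ k < n into blocks of d consecutive integers.  The reflection k ↦ k′ of a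
-- block satisfies k + k′ + 1 ≡ 0 (mod d) and changes the sign of the summand:
-- [k(k+1)] is invariant, while [2k+1] and w_k are multiplied by -q^(2k′+1) and
-- q^(α(2k′+1)); if d ∣ k(k+1), both summands are 0 because r > 0.  Hence every
-- block has sum 0.  For w_k the reflection is proved by recursion on j for
-- [k choose j][k+j choose j]: the factor relating j to j + 1 is symmetric, and at
-- the multiples of d, where this factor is of no use, q-Lucas shows that the
-- product is constant on the block.
--
-- Vanishing of f at the primitive d-th roots of unity is expressed without
-- cyclotomic polynomials as 1 - q^d ∣ f ∏[0<i<d] (1 - q^i).  As 1 - q^n has no
-- repeated factors, [n] ∣ f once this holds for all divisors d > 1 of n.

module Submission where

open import Defs
open import Algebra.Bundles using (CommutativeRing; Semiring)
open import Algebra.Definitions.RawMagma using (_,_; module _∣ʳ_)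
open import Algebra.Morphism.Structures using (IsSemiringHomomorphism)
open import Data.Bool.Base using (if_then_else_; true; false)
open import Data.Fin.Base using (toℕ)
import Data.Fin.Permutation as Perm
import Data.Fin.Properties as Finₚ
open import Data.Integer.Base as ℤ using (ℤ; +_; -[1+_])
import Data.Integer.DivMod as ℤ-DivMod
import Data.Integer.Properties as ℤₚ
import Data.Integer.Tactic.RingSolver as ℤ-Solver
open import Data.List.Base using ([]; _∷_; _++_; map)
open import Data.Maybe.Base using (Maybe; just; nothing)
open import Data.Nat.Base as ℕ using (ℕ; zero; suc; _≤_; _<_; z≤n; s≤s; NonZero)
open import Data.Nat.Combinatorics using (_C_)
import Data.Nat.Divisibility as ∣
open ∣ using (divides) renaming (_∣_ to _∣ℕ_; _∤_ to _∤ℕ_)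
open import Data.Nat.GCD
  using (gcd; gcd-GCD; gcd[m,n]∣m; gcd[m,n]∣n; gcd[m,n]≤n; gcd[m,n]≢0; module Bézout)
open import Data.Nat.Induction using (<-rec)
import Data.Nat.Properties as ℕₚ
import Data.Nat.Tactic.RingSolver as ℕ-Solver
open import Data.Product.Base using (_,_; ∃; ∃₂)
open import Data.Sum.Base using (inj₁; inj₂)
open import Level using (_⊔_)
open import Relation.Binary.PropositionalEquality as ≡ using (_≡_; _≢_)
open import Relation.Nullary using (yes; no; contradiction; does)
open import Relation.Nullary.Decidable using (dec-true; dec-false)

-- A ring solver with integer coefficients over any commutative ring.

module IntegerSolver {c ℓ} (R : CommutativeRing c ℓ) where
  open CommutativeRing R
  open import Algebra.Properties.Ring ring
    using (-‿distribˡ-*; -‿distribʳ-*; -0#≈0#; -‿+-comm; -‿involutive)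
  open import Algebra.Properties.CommutativeSemigroup +-commutativeSemigroup
    using (interchange)
  open import Algebra.Properties.Semiring.Mult.TCOptimised semiring
    using (_×_; 1+×; ×-homo-+; ×1-homo-*)
  open import Algebra.Solver.Ring.AlmostCommutativeRing
    using (fromCommutativeRing; _-Raw-AlmostCommutative⟶_)
  open import Relation.Binary.Reasoning.Setoid setoid

  ⟦_⟧ : ℤ → Carrier
  ⟦ + n      ⟧ = n × 1#
  ⟦ -[1+ n ] ⟧ = - (suc n × 1#)

  ⊖-homo : ∀ m n → ⟦ m ℤ.⊖ n ⟧ ≈ m × 1# - n × 1#
  ⊖-homo m       zero    = sym (trans (+-congˡ -0#≈0#) (+-identityʳ _))
  ⊖-homo zero    (suc n) = sym (+-identityˡ _)
  ⊖-homo (suc m) (suc n) = begin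
    ⟦ suc m ℤ.⊖ suc n ⟧                  ≡⟨ ≡.cong ⟦_⟧ (ℤₚ.[1+m]⊖[1+n]≡m⊖n m n) ⟩
    ⟦ m ℤ.⊖ n ⟧                          ≈⟨ ⊖-homo m n ⟩
    m × 1# - n × 1#                      ≈⟨ +-identityˡ _ ⟨
    0# + (m × 1# - n × 1#)               ≈⟨ +-congʳ (-‿inverseʳ 1#) ⟨
    (1# - 1#) + (m × 1# - n × 1#)        ≈⟨ interchange _ _ _ _ ⟩
    (1# + m × 1#) + (- 1# + - (n × 1#))  ≈⟨ +-congˡ (-‿+-comm _ _) ⟩
    (1# + m × 1#) - (1# + n × 1#)        ≈⟨ +-cong (1+× m 1#) (-‿cong (1+× n 1#)) ⟨
    suc m × 1# - suc n × 1#              ∎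

  +-homo : ∀ i j → ⟦ i ℤ.+ j ⟧ ≈ ⟦ i ⟧ + ⟦ j ⟧
  +-homo (+ m)    (+ n)    = ×-homo-+ 1# m n
  +-homo (+ m)    -[1+ n ] = ⊖-homo m (suc n)
  +-homo -[1+ m ] (+ n)    = trans (⊖-homo n (suc m)) (+-comm _ _)
  +-homo -[1+ m ] -[1+ n ] = begin
    - (suc (suc (m ℕ.+ n)) × 1#)       ≡⟨ ≡.cong (λ k → - (suc k × 1#)) (ℕₚ.+-suc m n) ⟨
    - ((suc m ℕ.+ suc n) × 1#)         ≈⟨ -‿cong (×-homo-+ 1# (suc m) (suc n)) ⟩
    - (suc m × 1# + suc n × 1#)        ≈⟨ -‿+-comm _ _ ⟨
    - (suc m × 1#) - suc n × 1#        ∎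

  -‿homo : ∀ i → ⟦ ℤ.- i ⟧ ≈ - ⟦ i ⟧
  -‿homo (+ zero)  = sym -0#≈0#
  -‿homo (+ suc n) = refl
  -‿homo -[1+ n ]  = sym (-‿involutive _)

  *-homo-+ : ∀ m n → ⟦ + m ℤ.* + n ⟧ ≈ ⟦ + m ⟧ * ⟦ + n ⟧
  *-homo-+ m n = trans (reflexive (≡.cong ⟦_⟧ (≡.sym (ℤₚ.pos-* m n)))) (×1-homo-* m n)

  *-homo : ∀ i j → ⟦ i ℤ.* j ⟧ ≈ ⟦ i ⟧ * ⟦ j ⟧
  *-homo-ʳ : ∀ m j → ⟦ + m ℤ.* j ⟧ ≈ ⟦ + m ⟧ * ⟦ j ⟧
  *-homo-ʳ m (+ n)    = *-homo-+ m n
  *-homo-ʳ m -[1+ n ] = begin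
    ⟦ + m ℤ.* -[1+ n ] ⟧         ≡⟨ ≡.cong ⟦_⟧ (ℤₚ.neg-distribʳ-* (+ m) (+ suc n)) ⟨
    ⟦ ℤ.- (+ m ℤ.* + suc n) ⟧    ≈⟨ -‿homo (+ m ℤ.* + suc n) ⟩
    - ⟦ + m ℤ.* + suc n ⟧        ≈⟨ -‿cong (*-homo-+ m (suc n)) ⟩
    - (⟦ + m ⟧ * ⟦ + suc n ⟧)    ≈⟨ -‿distribʳ-* _ _ ⟩
    ⟦ + m ⟧ * - ⟦ + suc n ⟧      ∎
  *-homo (+ m)    j = *-homo-ʳ m j
  *-homo -[1+ m ] j = begin
    ⟦ -[1+ m ] ℤ.* j ⟧           ≡⟨ ≡.cong ⟦_⟧ (ℤₚ.neg-distribˡ-* (+ suc m) j) ⟨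
    ⟦ ℤ.- (+ suc m ℤ.* j) ⟧      ≈⟨ -‿homo (+ suc m ℤ.* j) ⟩
    - ⟦ + suc m ℤ.* j ⟧          ≈⟨ -‿cong (*-homo-ʳ (suc m) j) ⟩
    - (⟦ + suc m ⟧ * ⟦ j ⟧)      ≈⟨ -‿distribˡ-* _ _ ⟩
    - ⟦ + suc m ⟧ * ⟦ j ⟧        ∎

  homomorphism : ℤ.+-*-rawRing -Raw-AlmostCommutative⟶ fromCommutativeRing R
  homomorphism = record
    { ⟦_⟧ = ⟦_⟧ ; +-homo = +-homo ; *-homo = *-homo ; -‿homo = -‿homo
    ; 0-homo = refl ; 1-homo = refl }

  -- Equality in `R` need not be decidable. Comparing the integers before they are mapped to `R` is
  -- sound, and it suffices for the solver to cancel terms.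
  _coeff≟_ : ∀ i j → Maybe (⟦ i ⟧ ≈ ⟦ j ⟧)
  i coeff≟ j with i ℤₚ.≟ j
  ... | yes i≡j = just (reflexive (≡.cong ⟦_⟧ i≡j))
  ... | no  _   = nothing

  open import Algebra.Solver.Ring ℤ.+-*-rawRing (fromCommutativeRing R)
    homomorphism _coeff≟_ public
    using (solve; _:=_; _:+_; _:*_; _:-_; :-_; con)

-- Sums over initial segments of the natural numbers.

module RangeSums {c ℓ} (R : CommutativeRing c ℓ) where
  open CommutativeRing R
  open RingNotation R using () renaming (sum<-syntax to sum<)
  open import Algebra.Properties.Semiring.Sum semiring
    using (sum-cong-≋; sum-permute; sum-replicate-zero; ∑-distrib-+; *-distribˡ-sum)
  open import Relation.Binary.Reasoning.Setoid setoid

  sum<-cong : ∀ n {f g} → (∀ i → i < n → f i ≈ g i) → sum< n f ≈ sum< n g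
  sum<-cong n eq = sum-cong-≋ {n} λ i → eq (toℕ i) (Finₚ.toℕ<n i)

  sum<-zero : ∀ n {f} → (∀ i → i < n → f i ≈ 0#) → sum< n f ≈ 0#
  sum<-zero n eq = trans (sum<-cong n eq) (sum-replicate-zero n)

  sum<-distrib-+ : ∀ n f g → sum< n (λ i → f i + g i) ≈ sum< n f + sum< n g
  sum<-distrib-+ n f g = ∑-distrib-+ {n} (λ i → f (toℕ i)) (λ i → g (toℕ i))

  *-distribˡ-sum< : ∀ n a f → a * sum< n f ≈ sum< n (λ i → a * f i)
  *-distribˡ-sum< n a f = *-distribˡ-sum {n} a (λ i → f (toℕ i))

  sum<-+ : ∀ m n f → sum< (m ℕ.+ n) f ≈ sum< m f + sum< n (λ i → f (m ℕ.+ i))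
  sum<-+ zero    n f = sym (+-identityˡ _)
  sum<-+ (suc m) n f = trans (+-congˡ (sum<-+ m n (λ i → f (suc i)))) (sym (+-assoc _ _ _))

  sum<-reverse : ∀ n f → sum< n f ≈ sum< n (λ i → f (n ℕ.∸ suc i))
  sum<-reverse n f = trans (sum-permute {n} (λ i → f (toℕ i)) Perm.reverse)
    (sum-cong-≋ {n} λ i → reflexive (≡.cong f (Finₚ.opposite-prop i)))

-- Ideals and quotient rings.

record IsIdeal {c ℓ ℓ′} (R : CommutativeRing c ℓ)
               (I : CommutativeRing.Carrier R → Set ℓ′) : Set (c ⊔ ℓ ⊔ ℓ′) where
  open CommutativeRing R
  field
    I-resp : ∀ {f g} → f ≈ g → I f → I g
    I-0    : I 0#
    I-+    : ∀ {f g} → I f → I g → I (f + g)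
    I-*    : ∀ f {g} → I g → I (f * g)

module QuotientRing {c ℓ ℓ′} (R : CommutativeRing c ℓ)
  {I : CommutativeRing.Carrier R → Set ℓ′} (isIdeal : IsIdeal R I) where
  open CommutativeRing R
  open IsIdeal isIdeal
  open IntegerSolver R using (solve; _:=_; _:+_; _:*_; _:-_; :-_; con)

  infix 4 _~_
  -- Wrapped in a record so that `f` and `g` can be recovered from the type of a congruence, which
  -- is not possible from `I (f - g)`.
  record _~_ (f g : Carrier) : Set ℓ′ where
    constructor congruent
    field difference : I (f - g)
  open _~_ public

  ≈⇒~ : ∀ {f g} → f ≈ g → f ~ g
  ≈⇒~ f≈g = congruent (I-resp (trans (sym (-‿inverseʳ _)) (+-congʳ (sym f≈g))) I-0)

  ~0⇒I : ∀ {f} → f ~ 0# → I f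
  ~0⇒I (congruent p) = I-resp (solve 1 (λ f → f :- con (+ 0) := f) refl _) p

  I⇒~0 : ∀ {f} → I f → f ~ 0#
  I⇒~0 p = congruent (I-resp (solve 1 (λ f → f := f :- con (+ 0)) refl _) p)

  private
    ~-sym : ∀ {f g} → f ~ g → g ~ f
    ~-sym (congruent p) = congruent (I-resp
      (solve 2 (λ f g → :- con (+ 1) :* (f :- g) := g :- f) refl _ _) (I-* (- 1#) p))

    ~-trans : ∀ {f g h} → f ~ g → g ~ h → f ~ h
    ~-trans (congruent p) (congruent q) = congruent (I-resp
      (solve 3 (λ f g h → (f :- g) :+ (g :- h) := f :- h) refl _ _ _) (I-+ p q))

    ~-+ : ∀ {f f′ g g′} → f ~ f′ → g ~ g′ → f + g ~ f′ + g′
    ~-+ (congruent p) (congruent q) = congruent (I-resp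
      (solve 4 (λ f f′ g g′ → (f :- f′) :+ (g :- g′) := f :+ g :- (f′ :+ g′)) refl _ _ _ _)
      (I-+ p q))

    ~-neg : ∀ {f g} → f ~ g → - f ~ - g
    ~-neg (congruent p) = congruent (I-resp
      (solve 2 (λ f g → :- con (+ 1) :* (f :- g) := :- f :- :- g) refl _ _) (I-* (- 1#) p))

    ~-* : ∀ {f f′ g g′} → f ~ f′ → g ~ g′ → f * g ~ f′ * g′
    ~-* (congruent p) (congruent q) = congruent (I-resp
      (solve 4 (λ f f′ g g′ → g :* (f :- f′) :+ f′ :* (g :- g′)
             := f :* g :- f′ :* g′) refl _ _ _ _)
      (I-+ (I-* _ p) (I-* _ q)))

  quotientRing : CommutativeRing c ℓ′
  quotientRing = record
    { Carrier = Carrier ; _≈_ = _~_ ; _+_ = _+_ ; _*_ = _*_ ; -_ = -_ ; 0# = 0# ; 1# = 1#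
    ; isCommutativeRing = record
      { isRing = record
        { +-isAbelianGroup = record
          { isGroup = record
            { isMonoid = record
              { isSemigroup = record
                { isMagma = record
                  { isEquivalence = record
                    { refl = ≈⇒~ refl ; sym = ~-sym ; trans = ~-trans }
                  ; ∙-cong = ~-+
                  }
                ; assoc = λ f g h → ≈⇒~ (+-assoc f g h)
                }
              ; identity = (λ f → ≈⇒~ (+-identityˡ f)) , λ f → ≈⇒~ (+-identityʳ f)
              }
            ; inverse = (λ f → ≈⇒~ (-‿inverseˡ f)) , λ f → ≈⇒~ (-‿inverseʳ f)
            ; ⁻¹-cong = ~-neg
            }
          ; comm = λ f g → ≈⇒~ (+-comm f g)
          }
        ; *-cong = ~-*
        ; *-assoc = λ f g h → ≈⇒~ (*-assoc f g h)
        ; *-identity = (λ f → ≈⇒~ (*-identityˡ f)) , λ f → ≈⇒~ (*-identityʳ f)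
        ; distrib = (λ f g h → ≈⇒~ (distribˡ f g h)) , λ f g h → ≈⇒~ (distribʳ f g h)
        }
      ; *-comm = λ f g → ≈⇒~ (*-comm f g)
      }
    }

-- Polynomials and their coefficients, also over a quotient ring.

module PolynomialRing {c ℓ} (R : CommutativeRing c ℓ) where
  open CommutativeRing R
  module R[ℕ] = MonoidAlgebra R ℕₚ.+-0-isCommutativeMonoid ℕₚ._≟_
  open R[ℕ] using (Element; coeff; monomial; coeffwise)
  private
    module Rx = RingNotation R[ℕ].commutativeRing
    open RingNotation R using (_∣_)
  open IntegerSolver R using (solve; _:=_; _:+_; _:*_; con)

  coeff-+ : ∀ f g i → coeff (f R[ℕ].+ g) i ≈ coeff f i + coeff g i
  coeff-+ []      g i = sym (+-identityˡ _)
  coeff-+ (t ∷ f) g i = trans (+-congˡ (coeff-+ f g i)) (sym (+-assoc _ _ _))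

  ι : Carrier → Element
  ι a = monomial a 0

  ι-homo : IsSemiringHomomorphism (Semiring.rawSemiring semiring)
             (Semiring.rawSemiring Rx.semiring) ι
  ι-homo = record
    { isNearSemiringHomomorphism = record
      { +-isMonoidHomomorphism = record
        { isMagmaHomomorphism = record
          { isRelHomomorphism = record { cong = λ eq → coeffwise λ
            { zero → +-congʳ eq ; (suc i) → refl } }
          ; homo = λ a b → coeffwise λ
            { zero → +-assoc a b 0# ; (suc i) → sym (+-identityˡ _) }
          }
        ; ε-homo = coeffwise λ { zero → +-identityʳ 0# ; (suc i) → +-identityʳ 0# }
        }
      ; *-homo = λ a b → Rx.refl
      }
    ; 1#-homo = Rx.refl
    }

  private
    coeff-*-ι : ∀ f b i → coeff (f R[ℕ].* ι b) i ≈ coeff f i * b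
    coeff-*-ι []            b i = sym (zeroˡ b)
    coeff-*-ι ((r , j) ∷ f) b i rewrite ℕₚ.+-identityʳ j with j ℕ.≡ᵇ i
    ... | true  = trans (+-congˡ (coeff-*-ι f b i)) (sym (distribʳ b _ _))
    ... | false = trans (+-congˡ (coeff-*-ι f b i))
                    (solve 2 (λ c b → con (+ 0) :+ c :* b := (con (+ 0) :+ c) :* b) refl _ _)

    tabulate : ℕ → (ℕ → Carrier) → Element
    tabulate zero    g = []
    tabulate (suc n) g = (g n , n) ∷ tabulate n g

    coeff-tabulate-≥ : ∀ n g i → n ≤ i → coeff (tabulate n g) i ≈ 0#
    coeff-tabulate-≥ zero    g i _   = refl
    coeff-tabulate-≥ (suc n) g i n<i
      rewrite dec-false (n ℕₚ.≟ i) (ℕₚ.<⇒≢ n<i) =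
      trans (+-identityˡ _) (coeff-tabulate-≥ n g i (ℕₚ.<⇒≤ n<i))

    coeff-tabulate-< : ∀ n g i → i < n → coeff (tabulate n g) i ≈ g i
    coeff-tabulate-< (suc n) g i (s≤s i≤n) with ℕₚ.m≤n⇒m<n∨m≡n i≤n
    ... | inj₂ ≡.refl rewrite dec-true (n ℕₚ.≟ n) ≡.refl =
      trans (+-congˡ (coeff-tabulate-≥ n g n ℕₚ.≤-refl)) (+-identityʳ _)
    ... | inj₁ i<n rewrite dec-false (n ℕₚ.≟ i) (ℕₚ.>⇒≢ i<n) =
      trans (+-identityˡ _) (coeff-tabulate-< n g i i<n)

    degree-bound : Element → ℕ
    degree-bound []            = 0
    degree-bound ((r , j) ∷ f) = suc j ℕ.⊔ degree-bound f

    coeff-degree : ∀ f i → degree-bound f ≤ i → coeff f i ≈ 0#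
    coeff-degree []            i _  = refl
    coeff-degree ((r , j) ∷ f) i ≤i
      rewrite dec-false (j ℕₚ.≟ i) (ℕₚ.<⇒≢ (ℕₚ.≤-trans (ℕₚ.m≤m⊔n (suc j) (degree-bound f)) ≤i)) =
      trans (+-identityˡ _) (coeff-degree f i (ℕₚ.≤-trans (ℕₚ.m≤n⊔m (suc j) _) ≤i))

  -- The quotients of the coefficients below `degree-bound f` are collected into one polynomial;
  -- beyond the bound `f` has coefficient 0. This reduces divisibility by a constant to the
  -- coefficient ring.
  coeffwise-∣ : ∀ b f → (∀ i → b ∣ coeff f i) → ι b Rx.∣ f
  coeffwise-∣ b f b∣ = quotients , coeffwise λ i → trans (coeff-*-ι quotients b i) (eq i)
    where
    open _∣ʳ_ using (quotient; equality)
    quotients : Element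
    quotients = tabulate (degree-bound f) (λ i → quotient (b∣ i))
    eq : ∀ i → coeff quotients i * b ≈ coeff f i
    eq i with i ℕₚ.<? degree-bound f
    ... | yes i<n = trans (*-congʳ (coeff-tabulate-< _ _ i i<n)) (equality (b∣ i))
    ... | no  i≮n = trans (*-congʳ (coeff-tabulate-≥ (degree-bound f) _ i (ℕₚ.≮⇒≥ i≮n)))
                   (trans (zeroˡ b) (sym (coeff-degree f i (ℕₚ.≮⇒≥ i≮n))))

-- Passing to a quotient ring changes the equality but none of the operations.
module QuotientOperations {c ℓ ℓ′} (R : CommutativeRing c ℓ)
  {I : CommutativeRing.Carrier R → Set ℓ′} (isIdeal : IsIdeal R I) where
  private
    module R = RingNotation R
    module K = RingNotation (QuotientRing.quotientRing R isIdeal)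
  module R[ℕ] = PolynomialRing.R[ℕ] R
  module K[ℕ] = PolynomialRing.R[ℕ] (QuotientRing.quotientRing R isIdeal)
  module Rx = RingNotation R[ℕ].commutativeRing
  module Kx = RingNotation K[ℕ].commutativeRing

  ^-≡ : ∀ a n → a K.^ n ≡ a R.^ n
  ^-≡ a zero    = ≡.refl
  ^-≡ a (suc n) = ≡.cong (a R.*_) (^-≡ a n)

  *-≡ : ∀ f g → f K[ℕ].* g ≡ f R[ℕ].* g
  *-≡ []      g = ≡.refl
  *-≡ (t ∷ f) g = ≡.cong ((t R[ℕ].· g) ++_) (*-≡ f g)

  ^ₓ-≡ : ∀ f n → f Kx.^ n ≡ f Rx.^ n
  ^ₓ-≡ f zero    = ≡.refl
  ^ₓ-≡ f (suc n) = ≡.trans (*-≡ f (f Kx.^ n)) (≡.cong (f R[ℕ].*_) (^ₓ-≡ f n))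

  sum-≡ : ∀ n {f g : ℕ → R[ℕ].Element} → (∀ i → f i ≡ g i) →
          Kx.sum<-syntax n f ≡ Rx.sum<-syntax n g
  sum-≡ zero    eq = ≡.refl
  sum-≡ (suc n) eq = ≡.cong₂ _++_ (eq 0) (sum-≡ n λ i → eq (suc i))

  coeff-≡ : ∀ f i → K[ℕ].coeff f i ≡ R[ℕ].coeff f i
  coeff-≡ []            i = ≡.refl
  coeff-≡ ((r , j) ∷ f) i =
    ≡.cong ((if does (j ℕₚ.≟ i) then r else R.0#) R.+_) (coeff-≡ f i)

-- Divisibility by 1 - q^d and vanishing at primitive roots of unity.

module Cyclotomic {c ℓ} (R : CommutativeRing c ℓ)
  (q^_ : ℤ → CommutativeRing.Carrier R) (regularPowers : RegularPowers R q^_)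
  where

  open RingNotation R
  open RegularPowers regularPowers
  open RingLemmas R
  module QA = QAnalogues R q^_ regularPowers
  open QA using ([]-spec; telescope)
  open import Algebra.Properties.Semiring.Mult semiring
    using (_×_; ×-assoc-*; ×-congʳ)
  open IntegerSolver R using (solve; _:=_; _:+_; _:*_; _:-_; :-_; con)
  open import Relation.Binary.Reasoning.Setoid setoid

  u : ℕ → Carrier
  u n = 1# - q^ (+ n)

  -- The quotient by each 1 - q^d with d > 0 has no additive torsion. This replaces division by
  -- integers, both in `squarefree` and when a sum is halved.
  TorsionFree : Set _
  TorsionFree = ∀ d h {f} → u (suc d) ∣ suc h × f → u (suc d) ∣ f

  ∏u : ℕ → Carrier
  ∏u zero    = 1#
  ∏u (suc m) = ∏u m * u (suc m)

  geometric : Carrier → ℕ → Carrier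
  geometric y zero    = 0#
  geometric y (suc h) = 1# + y * geometric y h

  u-* : ∀ h e → u (h ℕ.* e) ≈ geometric (q^ (+ e)) h * u e
  u-* zero    e = begin
    1# - q^ (+ 0)  ≈⟨ +-congˡ (-‿cong q^-0) ⟩
    1# - 1#        ≈⟨ solve 1 (λ y → con (+ 1) :- con (+ 1) := con (+ 0) :* y) refl (u e) ⟩
    0# * u e       ∎
  u-* (suc h) e = begin
    u (e ℕ.+ h ℕ.* e)                        ≈⟨ telescope (+ e) (+ (h ℕ.* e)) ⟨
    u e + y * u (h ℕ.* e)                    ≈⟨ +-congˡ (*-congˡ (u-* h e)) ⟩
    u e + y * (geometric y h * u e)
      ≈⟨ solve 3 (λ v y g → v :+ y :* (g :* v)
             := (con (+ 1) :+ y :* g) :* v) refl (u e) y (geometric y h) ⟩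
    (1# + y * geometric y h) * u e           ∎
    where y = q^ (+ e)

  -- Negative exponents are reduced to positive ones by 1 - y = -y (1 - y⁻¹).
  u-∣-1-q^* : ∀ e t → u e ∣ 1# - q^ (t ℤ.* + e)
  u-∣-1-q^* e (+ n) = geometric (q^ (+ e)) n ,
    trans (sym (u-* n e)) (reflexive (≡.cong (λ z → 1# - q^ z) (ℤₚ.pos-* n e)))
  u-∣-1-q^* e -[1+ n ] with s , eq ← u-∣-1-q^* e (+ suc n) = - (y * s) , (begin
    - (y * s) * u e
      ≈⟨ solve 3 (λ y s v → :- (y :* s) :* v := :- (y :* (s :* v))) refl _ _ _ ⟩
    - (y * (s * u e))          ≈⟨ -‿cong (*-congˡ eq) ⟩
    - (y * (1# - z))
      ≈⟨ solve 2 (λ y z → :- (y :* (con (+ 1) :- z)) := y :* z :- y) refl _ _ ⟩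
    y * z - y                  ≈⟨ +-congʳ (q^-+ _ _) ⟩
    q^ (-[1+ n ] ℤ.* + e ℤ.+ + suc n ℤ.* + e) - y
                               ≡⟨ ≡.cong (λ i → q^ i - y) (cancel (+ suc n) (+ e)) ⟩
    q^ ℤ.0ℤ - y                ≈⟨ +-congʳ q^-0 ⟩
    1# - y                     ∎)
    where
    y = q^ (-[1+ n ] ℤ.* + e)
    z = q^ (+ suc n ℤ.* + e)
    cancel : ∀ a b → ℤ.- a ℤ.* b ℤ.+ a ℤ.* b ≡ ℤ.0ℤ
    cancel = ℤ-Solver.solve-∀

  -- One step of division with remainder by `v`: as `y` is 1 modulo `v`, the term `m * y` adds `m`
  -- to the remainder.
  divide-term : ∀ {v y} m h g r f → h * v ≈ 1# - y → g * v + r ≈ f →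
                (- (m * h) + g) * v + (m + r) ≈ m * y + f
  divide-term {v} {y} m h g r f eq₁ eq₂ = begin
    (- (m * h) + g) * v + (m + r)
      ≈⟨ solve 5 (λ m h g v r → (:- (m :* h) :+ g) :* v :+ (m :+ r)
             := m :- m :* (h :* v) :+ (g :* v :+ r)) refl m h g v r ⟩
    m - m * (h * v) + (g * v + r)       ≈⟨ +-cong (+-congˡ (-‿cong (*-congˡ eq₁))) eq₂ ⟩
    m - m * (1# - y) + f
      ≈⟨ solve 3 (λ m y f → m :- m :* (con (+ 1) :- y) :+ f := m :* y :+ f) refl m y f ⟩
    m * y + f                           ∎

  -- At y = 1 each of the `h` summands of the geometric sum is 1, and a polynomial in y differs from
  -- its value at 1 by a multiple of 1 - y.
  geometric-at-1 : ∀ y h → ∃ λ t → h × 1# ≈ geometric y h + (1# - y) * t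
  geometric-at-1 y zero = 0# , solve 1 (λ y → con (+ 0)
         := con (+ 0) :+ (con (+ 1) :- y) :* con (+ 0)) refl y
  geometric-at-1 y (suc h) with t , eq ← geometric-at-1 y h =
    geometric y h + t , trans (+-congˡ eq)
      (solve 3 (λ y g t → con (+ 1) :+ (g :+ (con (+ 1) :- y) :* t)
                       := (con (+ 1) :+ y :* g) :+ (con (+ 1) :- y) :* (g :+ t))
        refl y (geometric y h) t)

  -- Bézout's identity applied to exponents: g + y d = x i gives 1 - q^g = (1 - q^(x i)) - q^g (1 -
  -- q^(y d)), and the two differences are multiples of `u i` and `u d`. The other sign is
  -- symmetric.
  u-gcd : ∀ i d → ∃₂ λ a b → u (gcd i d) ≈ a * u i + b * u d
  u-gcd i d with Bézout.identity (gcd-GCD i d)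
  ... | Bézout.+- x y eq = geometric (q^ (+ i)) x , - (q^ (+ g) * geometric (q^ (+ d)) y) , (begin
    u g
      ≈⟨ solve 3 (λ p Q v → p := (p :+ Q :* v) :- Q :* v) refl (u g) (q^ (+ g)) (u (y ℕ.* d)) ⟩
    u g + q^ (+ g) * u (y ℕ.* d) - q^ (+ g) * u (y ℕ.* d)
      ≈⟨ +-congʳ (trans (telescope (+ g) (+ (y ℕ.* d))) (reflexive (≡.cong u eq))) ⟩
    u (x ℕ.* i) - q^ (+ g) * u (y ℕ.* d)
      ≈⟨ +-cong (u-* x i) (-‿cong (*-congˡ (u-* y d))) ⟩
    geometric (q^ (+ i)) x * u i - q^ (+ g) * (geometric (q^ (+ d)) y * u d)
      ≈⟨ solve 4 (λ A Q G D → A :- Q :* (G :* D) := A :+ (:- (Q :* G)) :* D) refl _ _ _ _ ⟩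
    geometric (q^ (+ i)) x * u i + - (q^ (+ g) * geometric (q^ (+ d)) y) * u d ∎)
    where g = gcd i d
  ... | Bézout.-+ x y eq = - (q^ (+ g) * geometric (q^ (+ i)) x) , geometric (q^ (+ d)) y , (begin
    u g
      ≈⟨ solve 3 (λ p Q v → p := (p :+ Q :* v) :- Q :* v) refl (u g) (q^ (+ g)) (u (x ℕ.* i)) ⟩
    u g + q^ (+ g) * u (x ℕ.* i) - q^ (+ g) * u (x ℕ.* i)
      ≈⟨ +-congʳ (trans (telescope (+ g) (+ (x ℕ.* i))) (reflexive (≡.cong u eq))) ⟩
    u (y ℕ.* d) - q^ (+ g) * u (x ℕ.* i)
      ≈⟨ +-cong (u-* y d) (-‿cong (*-congˡ (u-* x i))) ⟩
    geometric (q^ (+ d)) y * u d - q^ (+ g) * (geometric (q^ (+ i)) x * u i)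
      ≈⟨ solve 4 (λ A Q G D → A :- Q :* (G :* D) := (:- (Q :* G)) :* D :+ A) refl _ _ _ _ ⟩
    - (q^ (+ g) * geometric (q^ (+ i)) x) * u i + geometric (q^ (+ d)) y * u d ∎)
    where g = gcd i d

  ∣-resp : ∀ {b f g} → f ≈ g → b ∣ f → b ∣ g
  ∣-resp eq (t , p) = t , trans p eq

  ∣-gcd : ∀ i d {f} → u d ∣ f * u i → u d ∣ f * u (gcd i d)
  ∣-gcd i d {f} (t , eq) with a , b , g≈ ← u-gcd i d = a * t + f * b , (begin
    (a * t + f * b) * u d
      ≈⟨ solve 5 (λ a t f b v → (a :* t :+ f :* b) :* v
             := a :* (t :* v) :+ f :* (b :* v)) refl a t f b (u d) ⟩
    a * (t * u d) + f * (b * u d)  ≈⟨ +-congʳ (*-congˡ eq) ⟩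
    a * (f * u i) + f * (b * u d)
      ≈⟨ solve 5 (λ a f i b v → a :* (f :* i) :+ f :* (b :* v)
             := f :* (a :* i :+ b :* v)) refl a f (u i) b (u d) ⟩
    f * (a * u i + b * u d)        ≈⟨ *-congˡ g≈ ⟨
    f * u (gcd i d)                ∎)

  ∏u-factor : ∀ e m → suc e ≤ m → ∃ λ t → ∏u m ≈ t * u (suc e)
  ∏u-factor e (suc m) (s≤s e≤m) with ℕₚ.m≤n⇒m<n∨m≡n e≤m
  ... | inj₂ ≡.refl = ∏u m , refl
  ... | inj₁ e<m with t , eq ← ∏u-factor e m e<m = t * u (suc m) ,
    trans (*-congʳ eq) (solve 3 (λ t e m → t :* e :* m := t :* m :* e) refl _ _ _)

  -- With h = d / e and N = (1 - q^d) / (1 - q^e), the integer h is a combination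
  -- of N and 1 - q^e.
  squarefree : TorsionFree → ∀ e d {f} → suc e ∣ℕ suc d →
               u (suc d) ∣ f * (u (suc e) * u (suc e)) →
               u (suc d) ∣ f * u (suc e)
  squarefree tf e d {f} (divides (suc h) d≡he) (t , eq)
    with s , h≈ ← geometric-at-1 (q^ (+ suc e)) (suc h) =
    tf d h (f + s * t , (begin
      (f + s * t) * u (suc d)   ≈⟨ *-congˡ u-d ⟩
      (f + s * t) * (N * y)
        ≈⟨ solve 5 (λ f s t N y → (f :+ s :* t) :* (N :* y)
               := (f :* N :+ s :* (t :* N)) :* y) refl f s t N y ⟩
      (f * N + s * (t * N)) * y ≈⟨ *-congʳ (+-congˡ (*-congˡ tN≈fy)) ⟩
      (f * N + s * (f * y)) * y
        ≈⟨ solve 4 (λ f N s y → (f :* N :+ s :* (f :* y)) :* y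
               := (N :+ y :* s) :* (f :* y)) refl f N s y ⟩
      (N + y * s) * (f * y)     ≈⟨ *-congʳ h≈ ⟨
      (suc h × 1#) * (f * y)    ≈⟨ ×-assoc-* (suc h) 1# (f * y) ⟩
      suc h × (1# * (f * y))    ≈⟨ ×-congʳ (suc h) (*-identityˡ _) ⟩
      suc h × (f * y)           ∎))
    where
    y = u (suc e)
    N = geometric (q^ (+ suc e)) (suc h)
    u-d : u (suc d) ≈ N * y
    u-d = trans (reflexive (≡.cong u d≡he)) (u-* (suc h) (suc e))
    tN≈fy : t * N ≈ f * y
    tN≈fy = regular-cancel (regular-1-q^ e) (begin
      t * N * y        ≈⟨ *-assoc _ _ _ ⟩
      t * (N * y)      ≈⟨ *-congˡ u-d ⟨
      t * u (suc d)    ≈⟨ eq ⟩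
      f * (y * y)      ≈⟨ *-assoc _ _ _ ⟨
      f * y * y        ∎)

  -- f vanishes at the primitive (d + 1)-th roots of unity.
  Vanishing : ℕ → Carrier → Set _
  Vanishing d f = u (suc d) ∣ f * ∏u d

  private
    gcd≡suc : ∀ i d → ∃ λ e → gcd i (suc d) ≡ suc e
    gcd≡suc i d with gcd i (suc d) | gcd[m,n]≢0 i (suc d) (inj₂ λ ())
    ... | zero  | ≢0 = contradiction ≡.refl ≢0
    ... | suc e | _  = e , ≡.refl

    gcd<  : ∀ {i d e} → suc d ∤ℕ i → gcd i (suc d) ≡ suc e → suc e ≤ d
    gcd< {i} {d} d∤i eq with ℕₚ.m≤n⇒m<n∨m≡n (gcd[m,n]≤n i (suc d))
    ... | inj₁ lt rewrite eq = ℕ.s≤s⁻¹ lt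
    ... | inj₂ g≡ = contradiction (≡.subst (_∣ℕ i) g≡ (gcd[m,n]∣m i (suc d))) d∤i

  -- The number E = gcd(i, d + 1) is a proper divisor of d + 1. Bézout turns the factor `u i` into
  -- `u E`, and `∏u d` already contains `u E`; `squarefree` removes the surplus factor.
  vanishing-cancel : TorsionFree → ∀ d i {f} → suc d ∤ℕ i →
                     Vanishing d (f * u i) → Vanishing d f
  vanishing-cancel tf d i {f} d∤i (t , eq)
    with e , g≡ ← gcd≡suc i d
    with s , E≈ ← ∏u-factor e d (gcd< d∤i g≡) =
    ∣-resp fsu≈ (squarefree tf e d e∣d (∣-resp fEg≈ fEg))
    where
    e∣d = ≡.subst (_∣ℕ suc d) g≡ (gcd[m,n]∣n i (suc d))
    fsu≈ : f * s * u (suc e) ≈ f * ∏u d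
    fsu≈ = trans (*-assoc _ _ _) (*-congˡ (sym E≈))
    fEg : u (suc d) ∣ f * ∏u d * u (gcd i (suc d))
    fEg = ∣-gcd i (suc d) (t , trans eq (solve 3 (λ f i E → f :* i :* E
           := f :* E :* i) refl _ _ _))
    fEg≈ : f * ∏u d * u (gcd i (suc d)) ≈ f * s * (u (suc e) * u (suc e))
    fEg≈ = begin
      f * ∏u d * u (gcd i (suc d))     ≡⟨ ≡.cong (λ k → f * ∏u d * u k) g≡ ⟩
      f * ∏u d * u (suc e)             ≈⟨ *-congʳ (*-congˡ E≈) ⟩
      f * (s * u (suc e)) * u (suc e)
        ≈⟨ solve 3 (λ f s e → f :* (s :* e) :* e := f :* s :* (e :* e)) refl _ _ _ ⟩
      f * s * (u (suc e) * u (suc e))  ∎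

  private
    -- The factors of `∏u m` are removed one at a time. Bézout replaces the last factor by `u E` for
    -- a proper divisor E of d + 1; since `f` itself is a multiple of `u E`, this factor occurs
    -- twice and `squarefree` drops one copy.
    descend : TorsionFree → ∀ d f → (∀ e → suc e ∣ℕ suc d → suc e ≤ d → u (suc e) ∣ f) →
              ∀ m → m ≤ d → u (suc d) ∣ f * ∏u m → u (suc d) ∣ f
    descend tf d f smaller zero    _   p = ∣-resp (*-identityʳ f) p
    descend tf d f smaller (suc m) m<d p
      with e , g≡ ← gcd≡suc (suc m) d
      with e≤d ← gcd< {suc m} {d} (∣.>⇒∤ (s≤s m<d)) g≡
      with e∣d ← ≡.subst (_∣ℕ suc d) g≡ (gcd[m,n]∣n (suc m) (suc d))
      with t , tu≈f ← smaller e e∣d e≤d =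
      descend tf d f smaller m (ℕₚ.<⇒≤ m<d)
        (∣-resp (back t tu≈f) (squarefree tf e d e∣d (∣-resp (forth t tu≈f) step)))
      where
      step : u (suc d) ∣ f * ∏u m * u (gcd (suc m) (suc d))
      step = ∣-gcd (suc m) (suc d) (∣-resp (sym (*-assoc _ _ _)) p)
      back : ∀ {e} t → t * u (suc e) ≈ f → t * ∏u m * u (suc e) ≈ f * ∏u m
      back t eq = trans (solve 3 (λ t P e → t :* P :* e := t :* e :* P) refl _ _ _) (*-congʳ eq)
      forth : ∀ t → t * u (suc e) ≈ f →
              f * ∏u m * u (gcd (suc m) (suc d)) ≈ t * ∏u m * (u (suc e) * u (suc e))
      forth t eq = begin
        f * ∏u m * u (gcd (suc m) (suc d))     ≡⟨ ≡.cong (λ k → f * ∏u m * u k) g≡ ⟩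
        f * ∏u m * u (suc e)                   ≈⟨ *-congʳ (back t eq) ⟨
        t * ∏u m * u (suc e) * u (suc e)       ≈⟨ *-assoc _ _ _ ⟩
        t * ∏u m * (u (suc e) * u (suc e))     ∎

  -- Strong induction on the divisor: the induction hypothesis covers its proper divisors, the
  -- vanishing hypothesis its primitive roots of unity, and `descend` combines both. The factor
  -- `u 1` accounts for the divisor 1, about which nothing is assumed.
  u-∣-u₁* : TorsionFree → ∀ n f →
    (∀ d → suc (suc d) ∣ℕ suc n → Vanishing (suc d) f) →
    ∀ d → suc d ∣ℕ suc n → u (suc d) ∣ f * u 1
  u-∣-u₁* tf n f vanishing = <-rec _ λ
    { zero    rec _   → f , refl
    ; (suc d) rec d∣n → descend tf (suc d) (f * u 1)
        (λ e e∣d e≤d → rec e≤d (∣.∣-trans e∣d d∣n))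
        (suc d) ℕₚ.≤-refl (times (vanishing d d∣n))
    }
    where
    times : ∀ {d} → Vanishing d f → Vanishing d (f * u 1)
    times (s , eq) = u 1 * s , trans (*-assoc _ _ _) (trans (*-congˡ eq)
      (solve 3 (λ v f P → v :* (f :* P) := f :* v :* P) refl _ _ _))

  -- Since [n] (1 - q) = 1 - q^n, the extra factor 1 - q can be cancelled.
  q-integer-∣ : TorsionFree → ∀ n f →
    (∀ d → suc (suc d) ∣ℕ suc n → Vanishing (suc d) f) → QA.[ + suc n ] ∣ f
  q-integer-∣ tf n f vanishing
    with t , eq ← u-∣-u₁* tf n f vanishing n ∣.∣-refl =
    t , regular-cancel (regular-1-q^ 0) (begin
      t * QA.[ + suc n ] * u 1    ≈⟨ *-assoc _ _ _ ⟩
      t * (QA.[ + suc n ] * u 1)  ≈⟨ *-congˡ ([]-spec (+ suc n)) ⟩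
      t * u (suc n)               ≈⟨ eq ⟩
      f * u 1                     ∎)

-- Identities of q-binomial coefficients for generic q.

module QBinomialIdentities {c ℓ} (R : CommutativeRing c ℓ)
  (q^_ : ℤ → CommutativeRing.Carrier R) (regularPowers : RegularPowers R q^_)
  where

  open RingNotation R
  open RegularPowers regularPowers
  open RingLemmas R
  open QAnalogues R q^_ regularPowers
    renaming ([_] to ⟦_⟧; [_choose_] to ⟦_choose_⟧)
  open IntegerSolver R using (solve; _:=_; _:+_; _:*_; con)
  open import Relation.Binary.Reasoning.Setoid setoid

  private
    regular-denominator : ∀ k → Regular (denominator k)
    regular-denominator k = regular-product k (λ j → ⟦ + j ⟧) regular-[]

    numerator-suc : ∀ N k → numerator (suc N) (suc k) ≈ ⟦ + suc N ⟧ * numerator N k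
    numerator-suc N k = *-cong (reflexive (≡.cong ⟦_⟧ (top (+ N))))
      (product-cong k λ j → reflexive (≡.cong ⟦_⟧ (shift (+ N) (+ j))))
      where
      top : ∀ a → + 1 ℤ.+ a ℤ.- + 1 ℤ.+ + 1 ≡ + 1 ℤ.+ a
      top = ℤ-Solver.solve-∀
      shift : ∀ a b → + 1 ℤ.+ a ℤ.- (+ 1 ℤ.+ b) ℤ.+ + 1 ≡ a ℤ.- b ℤ.+ + 1
      shift = ℤ-Solver.solve-∀

    numerator-last : ∀ N k → numerator N (suc k) ≈ numerator N k * ⟦ + N ℤ.- + k ⟧
    numerator-last N k =
      trans (product-last k (λ j → ⟦ + N ℤ.- + j ℤ.+ + 1 ⟧))
            (*-congˡ (reflexive (≡.cong ⟦_⟧ (last (+ N) (+ k)))))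
      where
      last : ∀ a b → a ℤ.- (+ 1 ℤ.+ b) ℤ.+ + 1 ≡ a ℤ.- b
      last = ℤ-Solver.solve-∀

  -- After multiplication by the regular `denominator k` both sides are the numerator of the
  -- binomial on the right; `lower` is proved in the same way.
  absorb : ∀ N k → ⟦ + suc N ⟧ * ⟦ N choose k ⟧ ≈ ⟦ + suc k ⟧ * ⟦ suc N choose suc k ⟧
  absorb N k = regular-cancel (regular-denominator k) (begin
    ⟦ + suc N ⟧ * B * denominator k              ≈⟨ *-assoc _ _ _ ⟩
    ⟦ + suc N ⟧ * (B * denominator k)            ≈⟨ *-congˡ (pascal-spec N k) ⟩
    ⟦ + suc N ⟧ * numerator N k                  ≈⟨ numerator-suc N k ⟨
    numerator (suc N) (suc k)                    ≈⟨ pascal-spec (suc N) (suc k) ⟨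
    B′ * denominator (suc k)                     ≈⟨ *-congˡ (product-last k (λ j → ⟦ + j ⟧)) ⟩
    B′ * (denominator k * ⟦ + suc k ⟧)
      ≈⟨ solve 3 (λ b d s → b :* (d :* s) := s :* b :* d) refl _ _ _ ⟩
    ⟦ + suc k ⟧ * B′ * denominator k             ∎)
    where
    B  = ⟦ N choose k ⟧
    B′ = ⟦ suc N choose suc k ⟧

  lower : ∀ N k → ⟦ + N ℤ.- + k ⟧ * ⟦ N choose k ⟧ ≈ ⟦ + suc k ⟧ * ⟦ N choose suc k ⟧
  lower N k = regular-cancel (regular-denominator k) (begin
    ⟦ + N ℤ.- + k ⟧ * B * denominator k          ≈⟨ *-assoc _ _ _ ⟩
    ⟦ + N ℤ.- + k ⟧ * (B * denominator k)        ≈⟨ *-congˡ (pascal-spec N k) ⟩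
    ⟦ + N ℤ.- + k ⟧ * numerator N k              ≈⟨ *-comm _ _ ⟩
    numerator N k * ⟦ + N ℤ.- + k ⟧              ≈⟨ numerator-last N k ⟨
    numerator N (suc k)                          ≈⟨ pascal-spec N (suc k) ⟨
    B′ * denominator (suc k)                     ≈⟨ *-congˡ (product-last k (λ j → ⟦ + j ⟧)) ⟩
    B′ * (denominator k * ⟦ + suc k ⟧)
      ≈⟨ solve 3 (λ b d s → b :* (d :* s) := s :* b :* d) refl _ _ _ ⟩
    ⟦ + suc k ⟧ * B′ * denominator k             ∎)
    where
    B  = ⟦ N choose k ⟧
    B′ = ⟦ N choose suc k ⟧

  choose-< : ∀ N k → N < k → ⟦ N choose k ⟧ ≈ 0#
  choose-< zero    (suc k) _         = refl
  choose-< (suc N) (suc k) (s≤s N<k) = begin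
    ⟦ N choose k ⟧ + q^ (+ suc k) * ⟦ N choose suc k ⟧
      ≈⟨ +-cong (choose-< N k N<k) (*-congˡ (choose-< N (suc k) (ℕₚ.m<n⇒m<1+n N<k))) ⟩
    0# + q^ (+ suc k) * 0#
      ≈⟨ solve 1 (λ z → con (+ 0) :+ z :* con (+ 0) := con (+ 0)) refl _ ⟩
    0# ∎

-- At a root of unity the denominators of q-binomial coefficients can vanish. The defining quotients
-- are therefore replaced by identities free of division, which survive the passage to a quotient
-- ring.
record QBinomials {c ℓ} (K : CommutativeRing c ℓ)
                  (q^_ : ℤ → CommutativeRing.Carrier K) : Set (c ⊔ ℓ) where
  open RingNotation K
  field
    ⟦_⟧        : ℤ → Carrier
    ⟦_choose_⟧ : ℕ → ℕ → Carrier
    []-spec    : ∀ z → ⟦ z ⟧ * (1# - q^ (+ 1)) ≈ 1# - q^ z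
    choose-0   : ∀ n → ⟦ n choose 0 ⟧ ≈ 1#
    pascal     : ∀ n k → ⟦ suc n choose suc k ⟧ ≈
                         ⟦ n choose k ⟧ + q^ (+ suc k) * ⟦ n choose suc k ⟧
    absorb     : ∀ n k → ⟦ + suc n ⟧ * ⟦ n choose k ⟧ ≈
                         ⟦ + suc k ⟧ * ⟦ suc n choose suc k ⟧
    lower      : ∀ n k → ⟦ + n ℤ.- + k ⟧ * ⟦ n choose k ⟧ ≈
                         ⟦ + suc k ⟧ * ⟦ n choose suc k ⟧
    choose-<   : ∀ n k → n < k → ⟦ n choose k ⟧ ≈ 0#

-- Primitivity is stated as regularity of 1 - q^i, not merely as q^i ≠ 1, so that such factors can
-- be cancelled although `K` is not known to be a domain.
record PrimitiveRoot {c ℓ} (K : CommutativeRing c ℓ) (d : ℕ)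
                     (q^_ : ℤ → CommutativeRing.Carrier K) : Set (c ⊔ ℓ) where
  open RingNotation K
  field
    q^-0    : q^ ℤ.0ℤ ≈ 1#
    q^-+    : ∀ a b → q^ a * q^ b ≈ q^ (a ℤ.+ b)
    q^-d    : q^ (+ d) ≈ 1#
    regular : ∀ i → d ∤ℕ i → Regular (1# - q^ (+ i))

-- The reflection of a block at a primitive d-th root of unity.

module Reflection {c ℓ} (K : CommutativeRing c ℓ) (e : ℕ)
  (q^_ : ℤ → CommutativeRing.Carrier K)
  (primitiveRoot : PrimitiveRoot K (suc (suc e)) q^_)
  (qBinomials : QBinomials K q^_) where

  open RingNotation K
  open RingLemmas K
  open PrimitiveRoot primitiveRoot
  open QBinomials qBinomials
  open IntegerSolver K using (solve; _:=_; _:+_; _:*_; _:-_; :-_; con)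
  open import Relation.Binary.Reasoning.Setoid setoid

  d : ℕ
  d = suc (suc e)

  private
    B : ℕ → ℕ → Carrier
    B = ⟦_choose_⟧

  q^-ℕ*d : ∀ n → q^ (+ n ℤ.* + d) ≈ 1#
  q^-ℕ*d zero    = q^-0
  q^-ℕ*d (suc n) = begin
    q^ (+ suc n ℤ.* + d)             ≡⟨ ≡.cong q^_ (ℤₚ.suc-* (+ n) (+ d)) ⟩
    q^ (+ d ℤ.+ + n ℤ.* + d)         ≈⟨ q^-+ (+ d) (+ n ℤ.* + d) ⟨
    q^ (+ d) * q^ (+ n ℤ.* + d)      ≈⟨ *-cong q^-d (q^-ℕ*d n) ⟩
    1# * 1#                          ≈⟨ *-identityˡ 1# ⟩
    1#                               ∎

  q^-*d : ∀ t → q^ (t ℤ.* + d) ≈ 1#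
  q^-*d (+ n)    = q^-ℕ*d n
  q^-*d -[1+ n ] = begin
    q^ (-[1+ n ] ℤ.* + d)                             ≈⟨ *-identityʳ _ ⟨
    q^ (-[1+ n ] ℤ.* + d) * 1#                        ≈⟨ *-congˡ (q^-ℕ*d (suc n)) ⟨
    q^ (-[1+ n ] ℤ.* + d) * q^ (+ suc n ℤ.* + d)
      ≈⟨ q^-+ (-[1+ n ] ℤ.* + d) (+ suc n ℤ.* + d) ⟩
    q^ (-[1+ n ] ℤ.* + d ℤ.+ + suc n ℤ.* + d)         ≡⟨ ≡.cong q^_ (cancel (+ suc n) (+ d)) ⟩
    q^ ℤ.0ℤ                                           ≈⟨ q^-0 ⟩
    1#                                                ∎
    where
    cancel : ∀ a b → ℤ.- a ℤ.* b ℤ.+ a ℤ.* b ≡ ℤ.0ℤ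
    cancel = ℤ-Solver.solve-∀

  q^-∣ : ∀ {i} → d ∣ℕ i → q^ (+ i) ≈ 1#
  q^-∣ (divides t ≡.refl) = trans (reflexive (≡.cong q^_ (ℤₚ.pos-* t d))) (q^-ℕ*d t)

  q^-periodic : ∀ {y z} t → y ≡ z ℤ.+ t ℤ.* + d → q^ y ≈ q^ z
  q^-periodic {y} {z} t ≡.refl = begin
    q^ (z ℤ.+ t ℤ.* + d)      ≈⟨ q^-+ z (t ℤ.* + d) ⟨
    q^ z * q^ (t ℤ.* + d)     ≈⟨ *-congˡ (q^-*d t) ⟩
    q^ z * 1#                 ≈⟨ *-identityʳ _ ⟩
    q^ z                      ∎

  regular-q^ : ∀ z → Regular (q^ z)
  regular-q^ z {f} eq = begin
    f                               ≈⟨ *-identityʳ f ⟨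
    f * 1#                          ≈⟨ *-congˡ q^-0 ⟨
    f * q^ ℤ.0ℤ                     ≡⟨ ≡.cong (λ y → f * q^ y) (ℤₚ.+-inverseʳ z) ⟨
    f * q^ (z ℤ.- z)                ≈⟨ *-congˡ (q^-+ z (ℤ.- z)) ⟨
    f * (q^ z * q^ (ℤ.- z))         ≈⟨ *-assoc _ _ _ ⟨
    f * q^ z * q^ (ℤ.- z)           ≈⟨ *-congʳ eq ⟩
    0# * q^ (ℤ.- z)                 ≈⟨ zeroˡ _ ⟩
    0#                              ∎

  q^-^ : ∀ z n → (q^ z) ^ n ≈ q^ (z ℤ.* + n)
  q^-^ z zero    = trans (sym q^-0) (reflexive (≡.cong q^_ (≡.sym (ℤₚ.*-zeroʳ z))))
  q^-^ z (suc n) = begin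
    q^ z * (q^ z) ^ n            ≈⟨ *-congˡ (q^-^ z n) ⟩
    q^ z * q^ (z ℤ.* + n)        ≈⟨ q^-+ z (z ℤ.* + n) ⟩
    q^ (z ℤ.+ z ℤ.* + n)         ≡⟨ ≡.cong q^_ (ℤₚ.*-suc z (+ n)) ⟨
    q^ (z ℤ.* + suc n)           ∎

  d∤1 : d ∤ℕ 1
  d∤1 = ∣.>⇒∤ (s≤s (s≤s z≤n))

  regular-1-q : Regular (1# - q^ (+ 1))
  regular-1-q = regular 1 d∤1

  regular-[] : ∀ i → d ∤ℕ i → Regular ⟦ + i ⟧
  regular-[] i d∤i {f} eq = regular i d∤i (begin
    f * (1# - q^ (+ i))              ≈⟨ *-congˡ ([]-spec (+ i)) ⟨
    f * (⟦ + i ⟧ * (1# - q^ (+ 1)))  ≈⟨ *-assoc _ _ _ ⟨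
    f * ⟦ + i ⟧ * (1# - q^ (+ 1))    ≈⟨ *-congʳ eq ⟩
    0# * (1# - q^ (+ 1))             ≈⟨ zeroˡ _ ⟩
    0#                               ∎)

  []-cong : ∀ {y z} → q^ y ≈ q^ z → ⟦ y ⟧ ≈ ⟦ z ⟧
  []-cong {y} {z} eq = regular-cancel regular-1-q
    (trans ([]-spec y) (trans (+-congˡ (-‿cong eq)) (sym ([]-spec z))))

  []-zero : ∀ i → d ∣ℕ i → ⟦ + i ⟧ ≈ 0#
  []-zero i d∣i = regular-1-q (begin
    ⟦ + i ⟧ * (1# - q^ (+ 1))  ≈⟨ []-spec _ ⟩
    1# - q^ (+ i)              ≈⟨ +-congˡ (-‿cong (q^-∣ d∣i)) ⟩
    1# - 1#                    ≈⟨ -‿inverseʳ 1# ⟩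
    0#                         ∎)

  []-suc : ∀ k → ⟦ + suc k ⟧ ≈ ⟦ + k ⟧ + q^ (+ k)
  []-suc k = regular-cancel regular-1-q (begin
    ⟦ + suc k ⟧ * v                    ≈⟨ []-spec _ ⟩
    1# - q^ (+ 1 ℤ.+ + k)              ≈⟨ +-congˡ (-‿cong (q^-+ (+ 1) (+ k))) ⟨
    1# - q^ (+ 1) * q^ (+ k)
      ≈⟨ solve 2 (λ p z → con (+ 1) :- p :* z
             := (con (+ 1) :- z) :+ z :* (con (+ 1) :- p)) refl _ _ ⟩
    1# - q^ (+ k) + q^ (+ k) * v       ≈⟨ +-congʳ ([]-spec (+ k)) ⟨
    ⟦ + k ⟧ * v + q^ (+ k) * v         ≈⟨ distribʳ v _ _ ⟨
    (⟦ + k ⟧ + q^ (+ k)) * v           ∎)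
    where v = 1# - q^ (+ 1)

  -- This is 1 - z = -z (1 - z⁻¹) divided by 1 - q; it is the source of the sign in the reflection
  -- of the summand.
  []-reflect : ∀ {y z} → q^ z * q^ y ≈ 1# → ⟦ z ⟧ ≈ - (q^ z * ⟦ y ⟧)
  []-reflect {y} {z} eq = regular-cancel regular-1-q (begin
    ⟦ z ⟧ * v                    ≈⟨ []-spec z ⟩
    1# - q^ z                    ≈⟨ +-congʳ eq ⟨
    q^ z * q^ y - q^ z
      ≈⟨ solve 2 (λ z y → z :* y :- z := :- (z :* (con (+ 1) :- y))) refl _ _ ⟩
    - (q^ z * (1# - q^ y))       ≈⟨ -‿cong (*-congˡ ([]-spec y)) ⟨
    - (q^ z * (⟦ y ⟧ * v))
      ≈⟨ solve 3 (λ z y v → :- (z :* (y :* v)) := :- (z :* y) :* v) refl _ _ _ ⟩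
    - (q^ z * ⟦ y ⟧) * v         ∎)
    where v = 1# - q^ (+ 1)

  -- The relevant case of the q-Lucas theorem.
  choose-suc : ∀ n j → d ∣ℕ suc j → d ∤ℕ suc n → B (suc n) (suc j) ≈ B n (suc j)
  choose-suc n j d∣j d∤n = begin
    B (suc n) (suc j)                        ≈⟨ pascal n j ⟩
    B n j + q^ (+ suc j) * B n (suc j)       ≈⟨ +-cong Bnj≈0 (*-congʳ (q^-∣ d∣j)) ⟩
    0# + 1# * B n (suc j)
      ≈⟨ solve 1 (λ b → con (+ 0) :+ con (+ 1) :* b := b) refl _ ⟩
    B n (suc j)                              ∎
    where
    Bnj≈0 : B n j ≈ 0#
    Bnj≈0 = regular-[] (suc n) d∤n (begin
      B n j * ⟦ + suc n ⟧                ≈⟨ *-comm _ _ ⟩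
      ⟦ + suc n ⟧ * B n j                ≈⟨ absorb n j ⟩
      ⟦ + suc j ⟧ * B (suc n) (suc j)    ≈⟨ *-congʳ ([]-zero (suc j) d∣j) ⟩
      0# * B (suc n) (suc j)             ≈⟨ zeroˡ _ ⟩
      0#                                 ∎)

  -- As b < d, none of n + 1, ..., n + b is a multiple of d, so `choose-suc` applies at every step.
  choose-block : ∀ b n j → d ∣ℕ suc j → d ∣ℕ n → b < d → B (b ℕ.+ n) (suc j) ≈ B n (suc j)
  choose-block zero    n j d∣j d∣n b<d = refl
  choose-block (suc b) n j d∣j d∣n b<d =
    trans (choose-suc (b ℕ.+ n) j d∣j λ d∣ → ∣.>⇒∤ b<d
             (∣.∣m+n∣m⇒∣n (≡.subst (d ∣ℕ_) (ℕₚ.+-comm (suc b) n) d∣) d∣n))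
          (choose-block b n j d∣j d∣n (ℕₚ.<-trans (ℕₚ.n<1+n b) b<d))

  -- A q-analogue of the coefficients of the Delannoy polynomials.
  delannoy : ℕ → ℕ → Carrier
  delannoy k j = B k j * B (k ℕ.+ j) j

  -- `lower` raises j in the first binomial and `absorb` in the second. The factor [k - j]
  -- [k + j + 1] is, up to a power of q, invariant under k ↦ -1 - k, which is the reflection modulo
  -- d.
  delannoy-suc : ∀ k j → ⟦ + suc j ⟧ * ⟦ + suc j ⟧ * delannoy k (suc j) ≈
                  ⟦ + k ℤ.- + j ⟧ * ⟦ + suc (k ℕ.+ j) ⟧ * delannoy k j
  delannoy-suc k j = begin
    s * s * (B k (suc j) * B (k ℕ.+ suc j) (suc j))
      ≡⟨ ≡.cong (λ i → s * s * (B k (suc j) * B i (suc j))) (ℕₚ.+-suc k j) ⟩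
    s * s * (B k (suc j) * B (suc (k ℕ.+ j)) (suc j))
      ≈⟨ solve 3 (λ s b c → s :* s :* (b :* c) := (s :* b) :* (s :* c)) refl _ _ _ ⟩
    (s * B k (suc j)) * (s * B (suc (k ℕ.+ j)) (suc j))
      ≈⟨ *-cong (lower k j) (absorb (k ℕ.+ j) j) ⟨
    (⟦ + k ℤ.- + j ⟧ * B k j) * (⟦ + suc (k ℕ.+ j) ⟧ * B (k ℕ.+ j) j)
      ≈⟨ solve 4 (λ a b c d → (a :* b) :* (c :* d) := a :* c :* (b :* d)) refl _ _ _ _ ⟩
    ⟦ + k ℤ.- + j ⟧ * ⟦ + suc (k ℕ.+ j) ⟧ * delannoy k j ∎
    where s = ⟦ + suc j ⟧

  -- The difference of products in the definition of w.
  Δ : ℕ → ℕ → Carrier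
  Δ k j = B (k ℕ.∸ 1) (j ℕ.∸ 1) * B (k ℕ.+ j) j - B k j * B (k ℕ.+ j) (j ℕ.∸ 1)

  -- After multiplication by [k + 1] [k + 2] both products in `Δ` are multiples of the same
  -- expression, with cofactors [k + 2] and [k + 1]; these differ by q^(k + 1).
  Δ-delannoy : ∀ k j → ⟦ + suc k ⟧ * ⟦ + suc (suc k) ⟧ * Δ (suc k) (suc j) ≈
                q^ (+ suc k) * (⟦ + suc j ⟧ * delannoy (suc k) (suc j))
  Δ-delannoy k j = begin
    sk * ssk * (v * v′ - y * y′)
      ≈⟨ solve 6 (λ sk ssk b b′ c c′ → sk :* ssk :* (b :* b′ :- c :* c′)
                   := ssk :* (sk :* b) :* b′ :- sk :* c :* (ssk :* c′)) refl sk ssk v v′ y y′ ⟩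
    ssk * (sk * v) * v′ - sk * y * (ssk * y′)
      ≈⟨ +-cong (*-congʳ (*-congˡ (absorb k j))) (-‿cong (*-congˡ lower′)) ⟩
    ssk * (sj * y) * v′ - sk * y * (sj * v′)
      ≈⟨ +-congʳ (*-congʳ (*-congʳ ([]-suc (suc k)))) ⟩
    (sk + z) * (sj * y) * v′ - sk * y * (sj * v′)
      ≈⟨ solve 5 (λ sk z sj c b → (sk :+ z) :* (sj :* c) :* b :- sk :* c :* (sj :* b)
                   := z :* (sj :* (c :* b))) refl sk z sj y v′ ⟩
    z * (sj * (y * v′)) ∎
    where
    z   = q^ (+ suc k)
    sj  = ⟦ + suc j ⟧
    sk  = ⟦ + suc k ⟧
    ssk = ⟦ + suc (suc k) ⟧
    N   = suc k ℕ.+ suc j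
    v   = B k j
    v′  = B N (suc j)
    y   = B (suc k) (suc j)
    y′  = B N j
    lower′ : ssk * y′ ≈ sj * v′
    lower′ = trans (*-congʳ (reflexive (≡.cong ⟦_⟧ (index (+ k) (+ j))))) (lower N j)
      where
      index : ∀ k j → + 1 ℤ.+ (+ 1 ℤ.+ k) ≡ + 1 ℤ.+ k ℤ.+ (+ 1 ℤ.+ j) ℤ.- j
      index = ℤ-Solver.solve-∀

  ∤⇒≢0 : ∀ {k} → d ∤ℕ k → k ≢ 0
  ∤⇒≢0 d∤k ≡.refl = d∤k (divides 0 ≡.refl)

  -- k and k′ are mirror images of each other inside the block
  -- a d, a d + 1, …, a d + d - 1.
  record Mirror (k k′ : ℕ) : Set where
    field
      a b b′ : ℕ
      k≡   : k ≡ b ℕ.+ a ℕ.* d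
      k′≡  : k′ ≡ b′ ℕ.+ a ℕ.* d
      b+b′ : suc (b ℕ.+ b′) ≡ d

  module _ {k k′} (mirror : Mirror k k′) where
    open Mirror mirror

    b<d : b < d
    b<d = ≡.subst (b <_) b+b′ (s≤s (ℕₚ.m≤m+n b b′))

    b′<d : b′ < d
    b′<d = ≡.subst (b′ <_) b+b′ (s≤s (ℕₚ.m≤n+m b′ b))

    k+k′+1 : k ℕ.+ k′ ℕ.+ 1 ≡ (2 ℕ.* a ℕ.+ 1) ℕ.* d
    k+k′+1 = ≡.trans (≡.cong₂ (λ i j → i ℕ.+ j ℕ.+ 1) k≡ k′≡)
      (≡.trans (collect b b′ (a ℕ.* d))
      (≡.trans (≡.cong (λ i → i ℕ.+ 2 ℕ.* (a ℕ.* d)) b+b′) (factor a d)))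
      where
      collect : ∀ b b′ c → b ℕ.+ c ℕ.+ (b′ ℕ.+ c) ℕ.+ 1 ≡ suc (b ℕ.+ b′) ℕ.+ 2 ℕ.* c
      collect = ℕ-Solver.solve-∀
      factor : ∀ a d → d ℕ.+ 2 ℕ.* (a ℕ.* d) ≡ (2 ℕ.* a ℕ.+ 1) ℕ.* d
      factor = ℕ-Solver.solve-∀

    q^-mirror : ∀ {y z} t → y ≡ z ℤ.+ t ℤ.* (+ k ℤ.+ + k′ ℤ.+ + 1) → q^ y ≈ q^ z
    q^-mirror {y} {z} t eq = q^-periodic (t ℤ.* + (2 ℕ.* a ℕ.+ 1))
      (≡.trans eq (≡.cong (λ s → z ℤ.+ s)
        (≡.trans (≡.cong (λ s → t ℤ.* s) (≡.trans (≡.cong +_ k+k′+1) (ℤₚ.pos-* (2 ℕ.* a ℕ.+ 1) d)))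
                 (≡.sym (ℤₚ.*-assoc t (+ (2 ℕ.* a ℕ.+ 1)) (+ d))))))

    -- Modulo `d` this exponent equals k′ - k.
    Q : ℤ
    Q = + 2 ℤ.* + k′ ℤ.+ + 1

    -- The reflection exchanges the two factors: modulo d, k′ - j is -(k + j + 1) and k′ + j + 1 is
    -- -(k - j). The two signs cancel.
    []-mirror : ∀ j → ⟦ + k′ ℤ.- + j ⟧ * ⟦ + suc (k′ ℕ.+ j) ⟧ ≈
                      q^ Q * (⟦ + k ℤ.- + j ⟧ * ⟦ + suc (k ℕ.+ j) ⟧)
    []-mirror j = begin
      ⟦ y ⟧ * ⟦ z ⟧
        ≈⟨ *-cong ([]-reflect inverse) ([]-reflect inverse′) ⟩
      - (q^ y * ⟦ + suc (k ℕ.+ j) ⟧) * - (q^ z * ⟦ + k ℤ.- + j ⟧)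
        ≈⟨ solve 4 (λ y a z b → :- (y :* a) :* :- (z :* b)
               := (y :* z) :* (b :* a)) refl _ _ _ _ ⟩
      q^ y * q^ z * (⟦ + k ℤ.- + j ⟧ * ⟦ + suc (k ℕ.+ j) ⟧)
        ≈⟨ *-congʳ (trans (q^-+ y z) (reflexive (≡.cong q^_ (total (+ k′) (+ j))))) ⟩
      q^ Q * (⟦ + k ℤ.- + j ⟧ * ⟦ + suc (k ℕ.+ j) ⟧) ∎
      where
      y = + k′ ℤ.- + j
      z = + suc (k′ ℕ.+ j)
      total : ∀ k′ j → k′ ℤ.- j ℤ.+ (+ 1 ℤ.+ (k′ ℤ.+ j)) ≡ + 2 ℤ.* k′ ℤ.+ + 1
      total = ℤ-Solver.solve-∀
      sum≡ : ∀ k k′ j → k′ ℤ.- j ℤ.+ (+ 1 ℤ.+ (k ℤ.+ j)) ≡ ℤ.0ℤ ℤ.+ + 1 ℤ.* (k ℤ.+ k′ ℤ.+ + 1)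
      sum≡ = ℤ-Solver.solve-∀
      sum≡′ : ∀ k k′ j → + 1 ℤ.+ (k′ ℤ.+ j) ℤ.+ (k ℤ.- j) ≡ ℤ.0ℤ ℤ.+ + 1 ℤ.* (k ℤ.+ k′ ℤ.+ + 1)
      sum≡′ = ℤ-Solver.solve-∀
      inverse : q^ y * q^ (+ suc (k ℕ.+ j)) ≈ 1#
      inverse = trans (q^-+ y _) (trans (q^-mirror (+ 1) (sum≡ (+ k) (+ k′) (+ j))) q^-0)
      inverse′ : q^ z * q^ (+ k ℤ.- + j) ≈ 1#
      inverse′ = trans (q^-+ z _) (trans (q^-mirror (+ 1) (sum≡′ (+ k) (+ k′) (+ j))) q^-0)

    delannoy-mirror : ∀ j → delannoy k′ j ≈ q^ (Q ℤ.* + j) * delannoy k j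
    delannoy-mirror zero = begin
      delannoy k′ 0                  ≈⟨ *-cong (choose-0 _) (choose-0 _) ⟩
      1# * 1#                 ≈⟨ *-cong (choose-0 _) (choose-0 _) ⟨
      delannoy k 0                   ≈⟨ *-identityˡ _ ⟨
      1# * delannoy k 0              ≈⟨ *-congʳ q^-0 ⟨
      q^ ℤ.0ℤ * delannoy k 0         ≡⟨ ≡.cong (λ z → q^ z * delannoy k 0) (ℤₚ.*-zeroʳ Q) ⟨
      q^ (Q ℤ.* + 0) * delannoy k 0  ∎
    delannoy-mirror (suc j) with d ∣.∣? suc j
    -- Here [j + 1] is regular, so the recursion in j determines the next value.
    ... | no d∤j = regular-cancel
      (regular-* (regular-[] (suc j) d∤j) (regular-[] (suc j) d∤j)) (begin
      delannoy k′ (suc j) * (s * s)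
        ≈⟨ *-comm _ _ ⟩
      s * s * delannoy k′ (suc j)
        ≈⟨ delannoy-suc k′ j ⟩
      ⟦ + k′ ℤ.- + j ⟧ * ⟦ + suc (k′ ℕ.+ j) ⟧ * delannoy k′ j
        ≈⟨ *-cong ([]-mirror j) (delannoy-mirror j) ⟩
      q^ Q * P * (q^ (Q ℤ.* + j) * delannoy k j)
        ≈⟨ solve 4 (λ a p b c → a :* p :* (b :* c) := a :* b :* (p :* c)) refl _ _ _ _ ⟩
      q^ Q * q^ (Q ℤ.* + j) * (P * delannoy k j)
        ≈⟨ *-cong (trans (q^-+ Q (Q ℤ.* + j)) (reflexive (≡.cong q^_ (≡.sym (ℤₚ.*-suc Q (+ j))))))
                  (sym (delannoy-suc k j)) ⟩
      q^ (Q ℤ.* + suc j) * (s * s * delannoy k (suc j))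
        ≈⟨ solve 3 (λ a s c → a :* (s :* s :* c) := a :* c :* (s :* s)) refl _ _ _ ⟩
      q^ (Q ℤ.* + suc j) * delannoy k (suc j) * (s * s) ∎)
      where
      s = ⟦ + suc j ⟧
      P = ⟦ + k ℤ.- + j ⟧ * ⟦ + suc (k ℕ.+ j) ⟧
    -- Here [j + 1] = 0 and the recursion gives nothing. Instead k and k′ are both compared with the
    -- first element a d of their block, and the power of q is 1.
    ... | yes d∣j = begin
      delannoy k′ (suc j)                       ≈⟨ block k′≡ b′<d ⟩
      delannoy (a ℕ.* d) (suc j)                ≈⟨ block k≡ b<d ⟨
      delannoy k (suc j)                        ≈⟨ *-identityˡ _ ⟨
      1# * delannoy k (suc j)                   ≈⟨ *-congʳ (q^1 d∣j) ⟨
      q^ (Q ℤ.* + suc j) * delannoy k (suc j)   ∎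
      where
      d∣ad : d ∣ℕ a ℕ.* d
      d∣ad = ∣.n∣m*n a
      block : ∀ {k b} → k ≡ b ℕ.+ a ℕ.* d → b < d → delannoy k (suc j) ≈ delannoy (a ℕ.* d) (suc j)
      -- The second binomial has top b + (a d + j + 1), again less than d above a multiple of d.
      block {_} {b} ≡.refl b<d = *-cong (choose-block b _ j d∣j d∣ad b<d)
        (trans (reflexive (≡.cong (λ n → B n (suc j)) (ℕₚ.+-assoc b (a ℕ.* d) (suc j))))
               (choose-block b _ j d∣j (∣.∣m∣n⇒∣m+n d∣ad d∣j) b<d))
      q^1 : d ∣ℕ suc j → q^ (Q ℤ.* + suc j) ≈ 1#
      q^1 (divides t eq) = trans
        (reflexive (≡.cong q^_ (≡.trans
          (≡.cong (λ i → Q ℤ.* i) (≡.trans (≡.cong +_ eq) (ℤₚ.pos-* t d)))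
          (≡.sym (ℤₚ.*-assoc Q (+ t) (+ d))))))
        (q^-*d (Q ℤ.* + t))

    -- If k′ were 0, then k + 1 would be (2a + 1) d. Positivity makes the truncated `k′ ∸ 1` in `Δ`
    -- exact.
    k′≢0 : d ∤ℕ suc k → k′ ≢ 0
    k′≢0 d∤k+1 ≡.refl = d∤k+1 (divides (2 ℕ.* a ℕ.+ 1)
      (≡.trans (≡.trans (ℕₚ.+-comm 1 k)
                        (≡.cong (λ i → i ℕ.+ 1) (≡.sym (ℕₚ.+-identityʳ k))))
               k+k′+1))

    -- By `Δ-delannoy`, `Δ` is obtained from `delannoy` through q^k and the regular element [k]
    -- [k + 1]. The reflection multiplies both by q^Q, the latter by `[]-mirror` at j = 0, so `Δ`
    -- transforms as `delannoy` does.
    Δ-mirror : d ∤ℕ k → d ∤ℕ suc k → ∀ j → Δ k′ (suc j) ≈ q^ (Q ℤ.* + suc j) * Δ k (suc j)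
    Δ-mirror d∤k d∤k+1 j = regular-cancel
      (regular-* (regular-q^ Q) (regular-* (regular-[] k d∤k) (regular-[] (suc k) d∤k+1))) (begin
      Δ k′ (suc j) * (q^ Q * P k)
        ≈⟨ *-congˡ P-mirror ⟨
      Δ k′ (suc j) * P k′
        ≈⟨ *-comm _ _ ⟩
      P k′ * Δ k′ (suc j)
        ≈⟨ Δ-delannoy′ (k′≢0 d∤k+1) ⟩
      q^ (+ k′) * (s * delannoy k′ (suc j))
        ≈⟨ *-cong q^k′ (*-congˡ (delannoy-mirror (suc j))) ⟩
      q^ Q * q^ (+ k) * (s * (z * delannoy k (suc j)))
        ≈⟨ solve 5 (λ p q s z c → p :* q :* (s :* (z :* c))
               := p :* z :* (q :* (s :* c))) refl _ _ _ _ _ ⟩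
      q^ Q * z * (q^ (+ k) * (s * delannoy k (suc j)))
        ≈⟨ *-congˡ (Δ-delannoy′ (∤⇒≢0 d∤k)) ⟨
      q^ Q * z * (P k * Δ k (suc j))
        ≈⟨ solve 4 (λ p z r a → p :* z :* (r :* a) := z :* a :* (p :* r)) refl _ _ _ _ ⟩
      z * Δ k (suc j) * (q^ Q * P k) ∎)
      where
      s = ⟦ + suc j ⟧
      z = q^ (Q ℤ.* + suc j)
      P : ℕ → Carrier
      P k = ⟦ + k ⟧ * ⟦ + suc k ⟧
      P≈ : ∀ k → ⟦ + k ℤ.- + 0 ⟧ * ⟦ + suc (k ℕ.+ 0) ⟧ ≈ P k
      P≈ k = reflexive (≡.cong (λ i → ⟦ + i ⟧ * ⟦ + suc i ⟧) (ℕₚ.+-identityʳ k))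
      P-mirror : P k′ ≈ q^ Q * P k
      P-mirror = trans (sym (P≈ k′)) (trans ([]-mirror 0) (*-congˡ (P≈ k)))
      q^k′ : q^ (+ k′) ≈ q^ Q * q^ (+ k)
      q^k′ = sym (trans (q^-+ Q (+ k)) (q^-mirror (+ 1) (sum≡ (+ k) (+ k′))))
        where
        sum≡ : ∀ k k′ → + 2 ℤ.* k′ ℤ.+ + 1 ℤ.+ k ≡ k′ ℤ.+ + 1 ℤ.* (k ℤ.+ k′ ℤ.+ + 1)
        sum≡ = ℤ-Solver.solve-∀
      Δ-delannoy′ : ∀ {k} → k ≢ 0 → P k * Δ k (suc j) ≈ q^ (+ k) * (s * delannoy k (suc j))
      Δ-delannoy′ {zero}  k≢0 = contradiction ≡.refl k≢0
      Δ-delannoy′ {suc k} _   = Δ-delannoy k j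

-- The reflection of w and of the summand, and the vanishing of block sums.

module MirrorPolynomials {c ℓ c′ ℓ′} (K : CommutativeRing c ℓ) (e : ℕ)
  (q^_ : ℤ → CommutativeRing.Carrier K)
  (primitiveRoot : PrimitiveRoot K (suc (suc e)) q^_)
  (qBinomials : QBinomials K q^_)
  (X : CommutativeRing c′ ℓ′)
  (ι : CommutativeRing.Carrier K → CommutativeRing.Carrier X)
  (ι-homo : IsSemiringHomomorphism (Semiring.rawSemiring (CommutativeRing.semiring K))
    (Semiring.rawSemiring (CommutativeRing.semiring X)) ι)
  (X-double : ∀ f → CommutativeRing._≈_ X (CommutativeRing._+_ X f f) (CommutativeRing.0# X) →
                    CommutativeRing._≈_ X f (CommutativeRing.0# X))
  (var : CommutativeRing.Carrier X)
  where

  open RingNotation K hiding (sum<-syntax; sum≤-syntax; product≤-syntax)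
  open PrimitiveRoot primitiveRoot
  open QBinomials qBinomials
  open Reflection K e q^_ primitiveRoot qBinomials
  open IsSemiringHomomorphism ι-homo using () renaming
    (⟦⟧-cong to ι-cong; +-homo to ι-+; *-homo to ι-*; 0#-homo to ι-0; 1#-homo to ι-1)
  private module X = RingNotation X
  open RangeSums X
  open import Algebra.Properties.Semiring.Exp semiring using (^-congˡ)
  open import Algebra.Properties.CommutativeSemiring.Exp commutativeSemiring using (^-distrib-*)
  open import Algebra.Properties.Semiring.Exp X.semiring using ()
    renaming (^-congˡ to X-^-congˡ)
  open import Algebra.Properties.CommutativeSemiring.Exp X.commutativeSemiring using ()
    renaming (^-distrib-* to X-^-distrib-*)
  open IntegerSolver K using (solve; _:=_; _:+_; _:*_; _:-_; :-_; con)

  ι-^ : ∀ a n → ι (a ^ n) X.≈ ι a X.^ n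
  ι-^ a zero    = ι-1
  ι-^ a (suc n) = X.trans (ι-* a (a ^ n)) (X.*-congˡ (ι-^ a n))

  exponent : ℕ → ℕ → ℕ → ℤ
  exponent α k j = + α ℤ.* (+ (suc j C 2) ℤ.- (+ k ℤ.+ + 1) ℤ.* (+ j ℤ.- + 1))

  term : ℕ → ℕ → ℕ → X.Carrier
  term α k j = ι (q^ exponent α k j * Δ k j ^ α) X.* var X.^ (j ℕ.∸ 1)

  W : ℕ → ℕ → X.Carrier
  W α k = X.sum≤-syntax k (term α k)

  -- In both products the first binomial has its top below its bottom. The case k = 0 is excluded
  -- because truncation of `k ∸ 1` gives `Δ 0 1` the value 1.
  Δ-zero : ∀ k j → k ≢ 0 → k < j → Δ k j ≈ 0#
  Δ-zero zero    j       k≢0 k<j       = contradiction ≡.refl k≢0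
  Δ-zero (suc k) (suc j) _   (s≤s k<j) = begin
    Δ (suc k) (suc j)
      ≈⟨ +-cong (*-congʳ (choose-< k j k<j))
                (-‿cong (*-congʳ (choose-< (suc k) (suc j) (s≤s k<j)))) ⟩
    0# * _ - 0# * _
      ≈⟨ solve 2 (λ a b → con (+ 0) :* a :- con (+ 0) :* b := con (+ 0)) refl _ _ ⟩
    0#                 ∎
    where open import Relation.Binary.Reasoning.Setoid setoid

  -- Brings the sums for k and k′, which have different lengths, to the common length k + k′. For α
  -- = 0 the added terms would not vanish, since `Δ k j ^ 0` is 1.
  W-extend : ∀ α k t → k ≢ 0 → α ≢ 0 → X.sum≤-syntax (k ℕ.+ t) (term α k) X.≈ W α k
  W-extend zero      k t k≢0 α≢0 = contradiction ≡.refl α≢0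
  W-extend α@(suc _) k t k≢0 _   = begin
    X.sum≤-syntax (k ℕ.+ t) (term α k)   ≈⟨ sum<-+ k t (λ i → term α k (suc i)) ⟩
    W α k X.+ _
      ≈⟨ X.+-congˡ (sum<-zero t λ i _ → vanish (suc (k ℕ.+ i)) (s≤s (ℕₚ.m≤m+n k i))) ⟩
    W α k X.+ X.0#                       ≈⟨ X.+-identityʳ _ ⟩
    W α k                                ∎
    where
    open import Relation.Binary.Reasoning.Setoid X.setoid
    vanish : ∀ j → k < j → term α k j X.≈ X.0#
    vanish j k<j = X.trans (X.*-congʳ (X.trans (ι-cong
      (trans (*-congˡ (trans (*-congʳ (Δ-zero k j k≢0 k<j)) (zeroˡ _))) (zeroʳ _))) ι-0))
      (X.zeroˡ _)

  module _ {k k′} (mirror : Mirror k k′) where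

    -- With J = j + 1, the power of `Δ` contributes q^(Q J α). The change of `exponent` absorbs q^(Q
    -- (J - 1) α) modulo d, which leaves a factor independent of j.
    term-mirror : ∀ α → d ∤ℕ k → d ∤ℕ suc k → ∀ j →
      term α k′ (suc j) X.≈ ι (q^ (Q mirror ℤ.* + α)) X.* term α k (suc j)
    term-mirror α d∤k d∤k+1 j = X.trans
      (X.*-congʳ (X.trans (ι-cong coefficient) (ι-* _ _))) (X.*-assoc _ _ _)
      where
      open import Relation.Binary.Reasoning.Setoid setoid
      J = + suc j
      z = Q mirror ℤ.* J
      coefficient : q^ exponent α k′ (suc j) * Δ k′ (suc j) ^ α ≈
                    q^ (Q mirror ℤ.* + α) * (q^ exponent α k (suc j) * Δ k (suc j) ^ α)
      coefficient = begin
        q^ exponent α k′ (suc j) * Δ k′ (suc j) ^ α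
          ≈⟨ *-congˡ (^-congˡ α (Δ-mirror mirror d∤k d∤k+1 j)) ⟩
        q^ exponent α k′ (suc j) * (q^ z * Δ k (suc j)) ^ α
          ≈⟨ *-congˡ (trans (^-distrib-* (q^ z) _ α) (*-congʳ (q^-^ z α))) ⟩
        q^ exponent α k′ (suc j) * (q^ (z ℤ.* + α) * Δ k (suc j) ^ α)
          ≈⟨ *-assoc _ _ _ ⟨
        q^ exponent α k′ (suc j) * q^ (z ℤ.* + α) * Δ k (suc j) ^ α
          ≈⟨ *-congʳ (trans (q^-+ _ _) (q^-mirror mirror (+ α ℤ.* (J ℤ.- + 1))
               (sum≡ (+ α) (+ k) (+ k′) J (+ (suc (suc j) C 2))))) ⟩
        q^ (Q mirror ℤ.* + α ℤ.+ exponent α k (suc j)) * Δ k (suc j) ^ α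
          ≈⟨ *-congʳ (q^-+ _ _) ⟨
        q^ (Q mirror ℤ.* + α) * q^ exponent α k (suc j) * Δ k (suc j) ^ α
          ≈⟨ *-assoc _ _ _ ⟩
        q^ (Q mirror ℤ.* + α) * (q^ exponent α k (suc j) * Δ k (suc j) ^ α) ∎
        where
        sum≡ : ∀ α k k′ J b →
          α ℤ.* (b ℤ.- (k′ ℤ.+ + 1) ℤ.* (J ℤ.- + 1)) ℤ.+ (+ 2 ℤ.* k′ ℤ.+ + 1) ℤ.* J ℤ.* α
          ≡ (+ 2 ℤ.* k′ ℤ.+ + 1) ℤ.* α ℤ.+ α ℤ.* (b ℤ.- (k ℤ.+ + 1) ℤ.* (J ℤ.- + 1))
            ℤ.+ α ℤ.* (J ℤ.- + 1) ℤ.* (k ℤ.+ k′ ℤ.+ + 1)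
        sum≡ = ℤ-Solver.solve-∀

    W-mirror : ∀ α → α ≢ 0 → d ∤ℕ k → d ∤ℕ suc k →
               W α k′ X.≈ ι (q^ (Q mirror ℤ.* + α)) X.* W α k
    W-mirror α α≢0 d∤k d∤k+1 = begin
      W α k′
        ≈⟨ W-extend α k′ k (k′≢0 mirror d∤k+1) α≢0 ⟨
      X.sum≤-syntax (k′ ℕ.+ k) (term α k′)
        ≡⟨ ≡.cong (λ i → X.sum≤-syntax i (term α k′)) (ℕₚ.+-comm k′ k) ⟩
      X.sum≤-syntax (k ℕ.+ k′) (term α k′)
        ≈⟨ sum<-cong (k ℕ.+ k′) (λ i _ → term-mirror α d∤k d∤k+1 i) ⟩
      X.sum≤-syntax (k ℕ.+ k′) (λ i → u X.* term α k i)
        ≈⟨ *-distribˡ-sum< (k ℕ.+ k′) u (λ i → term α k (suc i)) ⟨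
      u X.* X.sum≤-syntax (k ℕ.+ k′) (term α k)
        ≈⟨ X.*-congˡ (W-extend α k k′ (∤⇒≢0 d∤k) α≢0) ⟩
      u X.* W α k ∎
      where
      open import Relation.Binary.Reasoning.Setoid X.setoid
      u = ι (q^ (Q mirror ℤ.* + α))

  module _ (α m n r : ℕ) where

    coefficient : ℕ → Carrier
    coefficient k = ⟦ + (k ℕ.* (k ℕ.+ 1)) ⟧ ^ r * ⟦ + (2 ℕ.* k ℕ.+ 1) ⟧
                    * q^ ((+ n ℤ.- + 1 ℤ.- + k) ℤ.* (+ α ℤ.* + m ℤ.+ + 1))

    F : ℕ → X.Carrier
    F k = ι (coefficient k) X.* W α k X.^ m

    F-zero : r ≢ 0 → ∀ k → ⟦ + (k ℕ.* (k ℕ.+ 1)) ⟧ ≈ 0# → F k X.≈ X.0#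
    F-zero r≢0 k eq = X.trans (X.*-congʳ (X.trans (ι-cong (begin
      coefficient k   ≈⟨ *-congʳ (*-congʳ (power r r≢0)) ⟩
      0# * _ * _      ≈⟨ solve 2 (λ a b → con (+ 0) :* a :* b := con (+ 0)) refl _ _ ⟩
      0#              ∎)) ι-0)) (X.zeroˡ _)
      where
      open import Relation.Binary.Reasoning.Setoid setoid
      power : ∀ r → r ≢ 0 → ⟦ + (k ℕ.* (k ℕ.+ 1)) ⟧ ^ r ≈ 0#
      power zero    r≢0 = contradiction ≡.refl r≢0
      power (suc r) _   = trans (*-congʳ eq) (zeroˡ _)

    module _ {k k′} (mirror : Mirror k k′) where

      [k[k+1]]-mirror : ⟦ + (k′ ℕ.* (k′ ℕ.+ 1)) ⟧ ≈ ⟦ + (k ℕ.* (k ℕ.+ 1)) ⟧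
      [k[k+1]]-mirror = []-cong (q^-mirror mirror (+ k′ ℤ.- + k)
        (≡.trans (ℤₚ.pos-* k′ (k′ ℕ.+ 1)) (≡.trans (sum≡ (+ k) (+ k′))
          (≡.cong (λ i → i ℤ.+ (+ k′ ℤ.- + k) ℤ.* (+ k ℤ.+ + k′ ℤ.+ + 1))
                  (≡.sym (ℤₚ.pos-* k (k ℕ.+ 1)))))))
        where
        sum≡ : ∀ k k′ → k′ ℤ.* (k′ ℤ.+ + 1)
                      ≡ k ℤ.* (k ℤ.+ + 1) ℤ.+ (k′ ℤ.- k) ℤ.* (k ℤ.+ k′ ℤ.+ + 1)
        sum≡ = ℤ-Solver.solve-∀

      [2k+1]-mirror : ⟦ + (2 ℕ.* k′ ℕ.+ 1) ⟧ ≈ - (q^ Q mirror * ⟦ + (2 ℕ.* k ℕ.+ 1) ⟧)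
      [2k+1]-mirror = trans ([]-reflect (trans (q^-+ _ _) (trans (q^-mirror mirror (+ 2)
          (≡.trans (≡.cong₂ (λ i j → i ℤ.+ + 1 ℤ.+ (j ℤ.+ + 1)) (ℤₚ.pos-* 2 k′) (ℤₚ.pos-* 2 k))
                   (sum≡ (+ k) (+ k′)))) q^-0)))
        (-‿cong (*-congʳ (reflexive (≡.cong (λ i → q^ (i ℤ.+ + 1)) (ℤₚ.pos-* 2 k′)))))
        where
        sum≡ : ∀ k k′ → + 2 ℤ.* k′ ℤ.+ + 1 ℤ.+ (+ 2 ℤ.* k ℤ.+ + 1)
                      ≡ ℤ.0ℤ ℤ.+ + 2 ℤ.* (k ℤ.+ k′ ℤ.+ + 1)
        sum≡ = ℤ-Solver.solve-∀

      -- The factors -q^Q from [2k + 1] and q^(Q α m) from the m-th power of `W` give -q^(Q (α m +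
      -- 1)). The weight q^((n - 1 - k)(α m + 1)) compensates this up to the sign, because Q - k′ =
      -- k′ + 1 is -k modulo d.
      coefficient-mirror : coefficient k′ * q^ (Q mirror ℤ.* + α) ^ m + coefficient k ≈ 0#
      coefficient-mirror = begin
        h′ * b′ * q^ z′ * q^ (Q mirror ℤ.* + α) ^ m + coefficient k
          ≈⟨ +-congʳ (*-cong (*-congʳ (*-cong (^-congˡ r [k[k+1]]-mirror) [2k+1]-mirror))
                             (q^-^ (Q mirror ℤ.* + α) m)) ⟩
        h * - (q^ Q mirror * b) * q^ z′ * q^ y + coefficient k
          ≈⟨ solve 6 (λ h p b z y f → h :* :- (p :* b) :* z :* y :+ f
                 := f :- h :* b :* (p :* (z :* y))) refl _ _ _ _ _ _ ⟩
        coefficient k - h * b * (q^ Q mirror * (q^ z′ * q^ y))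
          ≈⟨ +-congˡ (-‿cong (*-congˡ (trans (*-congˡ (q^-+ z′ y))
               (trans (q^-+ (Q mirror) (z′ ℤ.+ y))
               (q^-mirror mirror (+ α ℤ.* + m ℤ.+ + 1)
                 (sum≡ (+ k) (+ k′) (+ n) (+ α) (+ m))))))) ⟩
        coefficient k - coefficient k
          ≈⟨ -‿inverseʳ _ ⟩
        0# ∎
        where
        open import Relation.Binary.Reasoning.Setoid setoid
        h  = ⟦ + (k ℕ.* (k ℕ.+ 1)) ⟧ ^ r
        h′ = ⟦ + (k′ ℕ.* (k′ ℕ.+ 1)) ⟧ ^ r
        b  = ⟦ + (2 ℕ.* k ℕ.+ 1) ⟧
        b′ = ⟦ + (2 ℕ.* k′ ℕ.+ 1) ⟧
        y  = Q mirror ℤ.* + α ℤ.* + m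
        z′ = (+ n ℤ.- + 1 ℤ.- + k′) ℤ.* (+ α ℤ.* + m ℤ.+ + 1)
        sum≡ : ∀ k k′ n α m →
          + 2 ℤ.* k′ ℤ.+ + 1 ℤ.+ ((n ℤ.- + 1 ℤ.- k′) ℤ.* (α ℤ.* m ℤ.+ + 1)
                                  ℤ.+ (+ 2 ℤ.* k′ ℤ.+ + 1) ℤ.* α ℤ.* m)
          ≡ (n ℤ.- + 1 ℤ.- k) ℤ.* (α ℤ.* m ℤ.+ + 1) ℤ.+ (α ℤ.* m ℤ.+ + 1) ℤ.* (k ℤ.+ k′ ℤ.+ + 1)
        sum≡ = ℤ-Solver.solve-∀

      F-mirror-zero : r ≢ 0 → d ∣ℕ k ℕ.* (k ℕ.+ 1) → F k′ X.+ F k X.≈ X.0#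
      F-mirror-zero r≢0 d∣ = X.trans
        (X.+-cong (F-zero r≢0 k′ (trans [k[k+1]]-mirror ([]-zero _ d∣)))
                  (F-zero r≢0 k ([]-zero _ d∣)))
        (X.+-identityˡ _)

      F-mirror : α ≢ 0 → r ≢ 0 → F k′ X.+ F k X.≈ X.0#
      F-mirror α≢0 r≢0 with d ∣.∣? k | d ∣.∣? suc k
      ... | yes d∣k | _         = F-mirror-zero r≢0 (∣.∣m⇒∣m*n (k ℕ.+ 1) d∣k)
      ... | no _    | yes d∣k+1 = F-mirror-zero r≢0
        (∣.∣n⇒∣m*n k (≡.subst (d ∣ℕ_) (≡.sym (ℕₚ.+-comm k 1)) d∣k+1))
      ... | no d∤k | no d∤k+1 = begin
        ι (coefficient k′) X.* W α k′ X.^ m X.+ F k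
          ≈⟨ X.+-congʳ (X.*-congˡ (X.trans (X-^-congˡ m (W-mirror mirror α α≢0 d∤k d∤k+1))
               (X.trans (X-^-distrib-* _ _ m) (X.*-congʳ (X.sym (ι-^ _ m)))))) ⟩
        ι (coefficient k′) X.* (ι (u ^ m) X.* W α k X.^ m) X.+ F k
          ≈⟨ X.+-congʳ (X.trans (X.sym (X.*-assoc _ _ _)) (X.*-congʳ (X.sym (ι-* _ _)))) ⟩
        ι (coefficient k′ * u ^ m) X.* W α k X.^ m X.+ F k
          ≈⟨ X.distribʳ _ _ _ ⟨
        (ι (coefficient k′ * u ^ m) X.+ ι (coefficient k)) X.* W α k X.^ m
          ≈⟨ X.*-congʳ (X.trans (X.sym (ι-+ _ _)) (X.trans (ι-cong coefficient-mirror) ι-0)) ⟩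
        X.0# X.* W α k X.^ m
          ≈⟨ X.zeroˡ _ ⟩
        X.0# ∎
        where
        open import Relation.Binary.Reasoning.Setoid X.setoid
        u = q^ (Q mirror ℤ.* + α)

    -- Adding the sum to its reversal pairs every index with its mirror image, so twice the sum is
    -- 0. Doubling also covers the middle of a block of odd length, which is its own mirror image.
    block-sum : α ≢ 0 → r ≢ 0 → ∀ a → X.sum<-syntax d (λ b → F (a ℕ.* d ℕ.+ b)) X.≈ X.0#
    block-sum α≢0 r≢0 a = X-double _ (begin
      S X.+ S
        ≈⟨ X.+-congˡ (sum<-reverse d G) ⟩
      S X.+ X.sum<-syntax d (λ b → G (d ℕ.∸ suc b))
        ≈⟨ sum<-distrib-+ d G (λ b → G (d ℕ.∸ suc b)) ⟨
      X.sum<-syntax d (λ b → G b X.+ G (d ℕ.∸ suc b))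
        ≈⟨ sum<-zero d (λ b b<d → F-mirror (record
             { a = a ; b = d ℕ.∸ suc b ; b′ = b
             ; k≡ = ℕₚ.+-comm (a ℕ.* d) _ ; k′≡ = ℕₚ.+-comm (a ℕ.* d) b
             ; b+b′ = ≡.trans (≡.cong suc (ℕₚ.+-comm (d ℕ.∸ suc b) b)) (ℕₚ.m+[n∸m]≡n b<d)
             }) α≢0 r≢0) ⟩
      X.0# ∎)
      where
      open import Relation.Binary.Reasoning.Setoid X.setoid
      G : ℕ → X.Carrier
      G b = F (a ℕ.* d ℕ.+ b)
      S = X.sum<-syntax d G

    blocks-sum : α ≢ 0 → r ≢ 0 → ∀ t → X.sum<-syntax (t ℕ.* d) F X.≈ X.0#
    blocks-sum α≢0 r≢0 zero    = X.refl
    blocks-sum α≢0 r≢0 (suc t) = begin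
      X.sum<-syntax (d ℕ.+ t ℕ.* d) F
        ≡⟨ ≡.cong (λ i → X.sum<-syntax i F) (ℕₚ.+-comm d (t ℕ.* d)) ⟩
      X.sum<-syntax (t ℕ.* d ℕ.+ d) F
        ≈⟨ sum<-+ (t ℕ.* d) d F ⟩
      X.sum<-syntax (t ℕ.* d) F X.+ X.sum<-syntax d (λ b → F (t ℕ.* d ℕ.+ b))
        ≈⟨ X.+-cong (blocks-sum α≢0 r≢0 t) (block-sum α≢0 r≢0 t) ⟩
      X.0# X.+ X.0#
        ≈⟨ X.+-identityˡ _ ⟩
      X.0# ∎
      where open import Relation.Binary.Reasoning.Setoid X.setoid

-- Generic q becomes a primitive root of unity in the quotient by `Vanishing`.

module VanishingQuotient {c ℓ} (R : CommutativeRing c ℓ)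
  (q^_ : ℤ → CommutativeRing.Carrier R) (regularPowers : RegularPowers R q^_)
  (torsionFree : Cyclotomic.TorsionFree R q^_ regularPowers) (e : ℕ) where

  open RingNotation R
  open RegularPowers regularPowers
  open Cyclotomic R q^_ regularPowers
  private
    module QI = QBinomialIdentities R q^_ regularPowers
  open IntegerSolver R using (solve; _:=_; _:+_; _:*_; _:-_; :-_; con)
  open import Relation.Binary.Reasoning.Setoid setoid

  isIdeal : IsIdeal R (Vanishing (suc e))
  isIdeal = record
    { I-resp = λ f≈g → ∣-resp (*-congʳ f≈g)
    ; I-0    = 0# , trans (zeroˡ _) (sym (zeroˡ _))
    ; I-+    = λ (s , p) (t , q) →
        s + t , trans (distribʳ _ s t) (trans (+-cong p q) (sym (distribʳ _ _ _)))
    ; I-*    = λ f (s , p) → f * s , trans (*-assoc f s _) (trans (*-congˡ p) (sym (*-assoc _ _ _)))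
    }

  open QuotientRing R isIdeal public

  primitiveRoot : PrimitiveRoot quotientRing (suc (suc e)) q^_
  primitiveRoot = record
    { q^-0    = ≈⇒~ q^-0
    ; q^-+    = λ a b → ≈⇒~ (q^-+ a b)
    ; q^-d    = congruent (- ∏u (suc e) ,
        solve 2 (λ p z → :- p :* (con (+ 1) :- z) := (z :- con (+ 1)) :* p) refl _ _)
    ; regular = λ i d∤i f[1-q]~0 → I⇒~0 (vanishing-cancel torsionFree (suc e) i d∤i (~0⇒I f[1-q]~0))
    }

  qBinomials : QBinomials quotientRing q^_
  qBinomials = record
    { ⟦_⟧        = QA.[_]
    ; ⟦_choose_⟧ = QA.[_choose_]
    ; []-spec    = λ z → ≈⇒~ (QA.[]-spec z)
    ; choose-0   = λ n → ≈⇒~ refl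
    ; pascal     = λ n k → ≈⇒~ refl
    ; absorb     = λ n k → ≈⇒~ (QI.absorb n k)
    ; lower      = λ n k → ≈⇒~ (QI.lower n k)
    ; choose-<   = λ n k n<k → ≈⇒~ (QI.choose-< n k n<k)
    }

  halve : ∀ {f} → f + f ~ 0# → f ~ 0#
  -- The argument 1 of `torsionFree` stands for the multiplier 2, and `2 × f` unfolds to f + (f +
  -- 0).
  halve {f} f+f~0 = I⇒~0 (torsionFree (suc e) 1 (∣-resp
    (solve 2 (λ f p → (f :+ f) :* p := f :* p :+ (f :* p :+ con (+ 0))) refl _ _) (~0⇒I f+f~0)))

  private
    module K[ℕ] = PolynomialRing.R[ℕ] quotientRing
    module K = CommutativeRing quotientRing

  halve-polynomial : ∀ f → f K[ℕ].+ f K[ℕ].≈ K[ℕ].0# → f K[ℕ].≈ K[ℕ].0#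
  halve-polynomial f f+f≈0 = K[ℕ].coeffwise λ i → halve
    (K.trans (K.sym (PolynomialRing.coeff-+ quotientRing f f i)) (K[ℕ].coeff-≈ f+f≈0 i))

-- Remainders of integers.

%ℕ-unique : ∀ N .{{_ : ℕ.NonZero N}} {r s} t → r < N → s < N → + r ≡ + s ℤ.+ t ℤ.* + N → r ≡ s
%ℕ-unique N {r} {s} t r<N s<N eq = ℤₚ.+-injective (≡.trans eq (≡.trans
  (≡.cong (λ i → + s ℤ.+ i ℤ.* + N) t≡0) (ℤₚ.+-identityʳ (+ s))))
  where
  open ℕₚ.≤-Reasoning
  r⊖s : r ℤ.⊖ s ≡ t ℤ.* + N
  r⊖s = ≡.trans (≡.sym (ℤₚ.m-n≡m⊖n r s))
       (≡.trans (≡.cong (λ i → i ℤ.- + s) eq) (cancel (+ s) (t ℤ.* + N)))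
    where
    cancel : ∀ a b → a ℤ.+ b ℤ.- a ≡ b
    cancel = ℤ-Solver.solve-∀
  ∣t∣N<1*N : ℤ.∣ t ∣ ℕ.* N < 1 ℕ.* N
  ∣t∣N<1*N = begin-strict
    ℤ.∣ t ∣ ℕ.* N      ≡⟨ ℤₚ.abs-* t (+ N) ⟨
    ℤ.∣ t ℤ.* + N ∣    ≡⟨ ≡.cong ℤ.∣_∣ r⊖s ⟨
    ℤ.∣ r ℤ.⊖ s ∣      ≤⟨ ℤₚ.∣m⊝n∣≤m⊔n r s ⟩
    r ℕ.⊔ s            <⟨ ℕₚ.⊔-lub r<N s<N ⟩
    N                  ≡⟨ ℕₚ.*-identityˡ N ⟨
    1 ℕ.* N            ∎
  t≡0 : t ≡ ℤ.0ℤ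
  t≡0 = ℤₚ.∣i∣≡0⇒i≡0 (ℕₚ.n<1⇒n≡0 (ℕₚ.*-cancelʳ-< N _ 1 ∣t∣N<1*N))

-- Both remainders are below N and differ by a multiple of N, and such a multiple of absolute value
-- less than N is 0.
%ℕ-periodic : ∀ z N .{{_ : ℕ.NonZero N}} → (z ℤ.+ + N) ℤ.%ℕ N ≡ z ℤ.%ℕ N
%ℕ-periodic z N = %ℕ-unique N (z ℤ./ℕ N ℤ.+ + 1 ℤ.- z′ ℤ./ℕ N)
  (ℤ-DivMod.n%ℕd<d z′ N) (ℤ-DivMod.n%ℕd<d z N)
  (rearrange (+ (z′ ℤ.%ℕ N)) (+ (z ℤ.%ℕ N)) (z ℤ./ℕ N) (z′ ℤ./ℕ N) (+ N)
    (≡.trans (≡.sym (ℤ-DivMod.a≡a%ℕn+[a/ℕn]*n z′ N))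
             (≡.cong (λ i → i ℤ.+ + N) (ℤ-DivMod.a≡a%ℕn+[a/ℕn]*n z N))))
  where
  z′ = z ℤ.+ + N
  rearrange : ∀ r s t t′ N → r ℤ.+ t′ ℤ.* N ≡ s ℤ.+ t ℤ.* N ℤ.+ N →
              r ≡ s ℤ.+ (t ℤ.+ + 1 ℤ.- t′) ℤ.* N
  rearrange r s t t′ N eq =
    ≡.trans (left r t′ N) (≡.trans (≡.cong (λ i → i ℤ.- t′ ℤ.* N) eq) (right s t t′ N))
    where
    left : ∀ r t′ N → r ≡ r ℤ.+ t′ ℤ.* N ℤ.- t′ ℤ.* N
    left = ℤ-Solver.solve-∀
    right : ∀ s t t′ N →
            s ℤ.+ t ℤ.* N ℤ.+ N ℤ.- t′ ℤ.* N ≡ s ℤ.+ (t ℤ.+ + 1 ℤ.- t′) ℤ.* N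
    right = ℤ-Solver.solve-∀

-- Torsion-freeness of Laurent polynomials modulo 1 - q^N.

module LaurentTorsion where
  open ℤ[ℤ] using (coeff; coeffwise; monomial;
    linear; linear-+; linear-*; linear-cong; linear-congˡ)
  open RingNotation ℤ[ℤ].commutativeRing
  open Cyclotomic ℤ[ℤ].commutativeRing q^_ LaurentProperties.regularPowers
    using (u; u-∣-1-q^*; divide-term)
  open import Algebra.Properties.Semiring.Mult semiring using (_×_)

  linear-× : ∀ φ h f → linear φ (h × f) ≡ + h ℤ.* linear φ f
  linear-× φ zero    f = ≡.refl
  linear-× φ (suc h) f = ≡.trans (linear-+ φ f (h × f))
    (≡.trans (≡.cong (λ i → linear φ f ℤ.+ i) (linear-× φ h f))
             (≡.sym (ℤₚ.suc-* (+ h) (linear φ f))))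

  linear-0 : ∀ f → linear (λ _ → ℤ.0ℤ) f ≡ ℤ.0ℤ
  linear-0 []            = ≡.refl
  linear-0 ((r , e) ∷ f) = ≡.cong₂ ℤ._+_ (ℤₚ.*-zeroʳ r) (linear-0 f)

  module _ (N-1 : ℕ) where
    N : ℕ
    N = suc N-1

    -- reduce f is the remainder of f modulo 1 - q^N; its coefficients are the sums of
    -- those of f over the residue classes modulo N, which makes torsion visible.
    reduce : Laurent → Laurent
    reduce = map λ (r , z) → r , + (z ℤ.%ℕ N)

    indicator : ℤ → ℕ → ℤ
    indicator c r = if does (+ r ℤₚ.≟ c) then ℤ.1ℤ else ℤ.0ℤ

    residue : ℤ → ℤ → ℤ
    residue c z = indicator c (z ℤ.%ℕ N)

    coeff-reduce : ∀ f c → coeff (reduce f) c ≡ linear (residue c) f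
    coeff-reduce []            c = ≡.refl
    coeff-reduce ((r , z) ∷ f) c with + (z ℤ.%ℕ N) ℤₚ.≟ c
    ... | yes _ = ≡.cong₂ ℤ._+_ (≡.sym (ℤₚ.*-identityʳ r)) (coeff-reduce f c)
    ... | no  _ = ≡.cong₂ ℤ._+_ (≡.sym (ℤₚ.*-zeroʳ r)) (coeff-reduce f c)

    -- A shift of exponents by N preserves residue classes, so the two terms of 1 - q^N contribute
    -- opposite amounts to each class sum.
    residue-annihilates : ∀ c g → linear (residue c) (g * u N) ≡ ℤ.0ℤ
    residue-annihilates c g = ≡.trans (linear-* (residue c) g (u N))
      (≡.trans (linear-congˡ g inner) (linear-0 g))
      where
      cancel : ∀ a → + 1 ℤ.* a ℤ.+ (ℤ.- + 1 ℤ.* a ℤ.+ ℤ.0ℤ) ≡ ℤ.0ℤ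
      cancel = ℤ-Solver.solve-∀
      inner : ∀ z → linear (λ y → residue c (z ℤ.+ y)) (u N) ≡ ℤ.0ℤ
      inner z = ≡.trans
        (≡.cong₂ (λ y r → + 1 ℤ.* residue c y ℤ.+ (ℤ.- + 1 ℤ.* indicator c r ℤ.+ ℤ.0ℤ))
                 (ℤₚ.+-identityʳ z) (%ℕ-periodic z N))
        (cancel (residue c z))

    -- Division with remainder, term by term: the exponent z is z mod N plus a multiple of N, to
    -- which `divide-term` applies.
    reduce-≡ : ∀ f → ∃ λ g → g * u N + reduce f ≈ f
    reduce-≡ []            = 0# , refl
    reduce-≡ ((r , z) ∷ f) with g , eq ← reduce-≡ f | h , 1-q^y ← u-∣-1-q^* N (z ℤ./ℕ N) =
      - (M * h) + g , trans (divide-term M h g (reduce f) f 1-q^y eq) (reflexive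
        (≡.cong₂ (λ r z → monomial r z + f) (ℤₚ.*-identityʳ r)
                 (≡.sym (ℤ-DivMod.a≡a%ℕn+[a/ℕn]*n z N))))
      where M = monomial r (+ (z ℤ.%ℕ N))

    -- The class sums of a multiple of 1 - q^N vanish. If this holds for (h + 1) f, it holds for
    -- `f`, because the integers have no zero divisors; then the remainder of `f` is 0.
    torsionFree : ∀ h {f} → u N ∣ suc h × f → u N ∣ f
    torsionFree h {f} (g , gu≈hf) with s , su+r≈f ← reduce-≡ f =
      s , trans (sym (+-identityʳ _)) (trans (+-congˡ (sym reduce≈0)) su+r≈f)
      where
      reduce≈0 : reduce f ≈ 0#
      reduce≈0 = coeffwise λ c → ≡.trans (coeff-reduce f c) (ℤₚ.*-cancelˡ-≡ (+ suc h) _ _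
        (≡.trans (≡.sym (linear-× (residue c) (suc h) f))
        (≡.trans (≡.sym (linear-cong (residue c) gu≈hf))
        (≡.trans (residue-annihilates c g) (≡.sym (ℤₚ.*-zeroʳ (+ suc h)))))))

-- From the quotient rings back to the congruence for Laurent polynomials.

open import Data.Integer.Base using (_+_; _-_; _*_)
open Cyclotomic ℤ[ℤ].commutativeRing q^_ LaurentProperties.regularPowers
  using (Vanishing; q-integer-∣)

summand : ℕ → ℕ → ℕ → ℕ → ℕ → Poly
summand α m n r k =
  const ([ + (k ℕ.* (k ℕ.+ 1)) ] L.^ r L.* [ + (2 ℕ.* k ℕ.+ 1) ]
         L.* q^ ((+ n - + 1 - + k) * (+ α * + m + + 1)))
  P.* w α k P.^ m

module _ (α m n r e : ℕ) where
  open VanishingQuotient ℤ[ℤ].commutativeRing q^_ LaurentProperties.regularPowers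
    LaurentTorsion.torsionFree e
  open QuotientOperations ℤ[ℤ].commutativeRing isIdeal
  open PolynomialRing quotientRing using (ι; ι-homo)
  open Reflection quotientRing e q^_ primitiveRoot qBinomials using (Δ)
  open MirrorPolynomials quotientRing e q^_ primitiveRoot qBinomials
    K[ℕ].commutativeRing ι ι-homo halve-polynomial x
  private module K = RingNotation quotientRing

  -- The two rings share their operations, so both sides are the same list of terms; this allows `≡`
  -- and hence transport between the two equalities.
  W≡w : ∀ k → W α k ≡ w α k
  W≡w k = sum-≡ k {λ i → term α k (suc i)} λ i →
    let q^e = q^ exponent α k (suc i); δ = Δ k (suc i) in
    ≡.trans (*-≡ (ι (q^e L.* δ K.^ α)) (x Kx.^ i))
            (≡.cong₂ P._*_ (≡.cong (λ a → const (q^e L.* a)) (^-≡ δ α)) (^ₓ-≡ x i))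

  F≡summand : ∀ k → F α m n r k ≡ summand α m n r k
  F≡summand k = ≡.trans (*-≡ (ι (coefficient α m n r k)) (W α k Kx.^ m)) (≡.cong₂ P._*_
    (≡.cong (λ a → const (a L.* [ + (2 ℕ.* k ℕ.+ 1) ]
                          L.* q^ ((+ n - + 1 - + k) * (+ α * + m + + 1))))
            (^-≡ [ + (k ℕ.* (k ℕ.+ 1)) ] r))
    (≡.trans (^ₓ-≡ (W α k) m) (≡.cong (λ f → f P.^ m) (W≡w k))))

  -- For n = t d the range consists of t complete blocks, so the sum is 0 over the quotient ring and
  -- each of its coefficients lies in the ideal.
  sum-vanishing : α ≢ 0 → r ≢ 0 → suc (suc e) ∣ℕ n → ∀ i →
    Vanishing (suc e) (L[ℕ].coeff (∑[0≤ k < n ] summand α m n r k) i)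
  sum-vanishing α≢0 r≢0 (divides t n≡td) i = ~0⇒I (≡.subst (_~ L.0#) coeff≡
    (K[ℕ].coeff-≈ (blocks-sum α m n r α≢0 r≢0 t) i))
    where
    S = Kx.sum<-syntax (t ℕ.* suc (suc e)) (F α m n r)
    coeff≡ : K[ℕ].coeff S i ≡ L[ℕ].coeff (∑[0≤ k < n ] summand α m n r k) i
    coeff≡ = ≡.trans (coeff-≡ S i) (≡.cong (λ f → L[ℕ].coeff f i)
      (≡.trans (sum-≡ (t ℕ.* suc (suc e)) F≡summand)
               (≡.cong (λ n′ → P.sum<-syntax n′ (summand α m n r)) (≡.sym n≡td))))

theorem1 : (α m n r : ℕ)
    .{{_ : NonZero α}} .{{_ : NonZero m}} .{{_ : NonZero n}} .{{_ : NonZero r}} →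
    const [ + n ] P.∣
    ∑[0≤ k < n ]
    (const ([ + (k ℕ.* (k ℕ.+ 1)) ] L.^ r L.* [ + (2 ℕ.* k ℕ.+ 1) ]
    L.* q^ ((+ n - + 1 - + k) * (+ α * + m + + 1)))
    P.* w α k P.^ m)
theorem1 α m n@(suc n-1) r =
  PolynomialRing.coeffwise-∣ ℤ[ℤ].commutativeRing [ + n ] _ λ i →
  -- The number e + 2 runs over the divisors of n greater than 1.
  q-integer-∣ LaurentTorsion.torsionFree n-1 _ λ e d∣n →
    sum-vanishing α m n r e (ℕ.≢-nonZero⁻¹ α) (ℕ.≢-nonZero⁻¹ r) d∣n i
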